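{- Let $M \in \mathcal{S}_n$ be a singular maximizer of $C_3$. The following conditions are equivalent: (i) $M$ is a trivial singular maximizer of $C_3$; (ii) $M$ is obtained by adding a source or a sink to a regular or almost regular tournament of order $n-1$; (iii) $M$ has a strongly connected component of order $1$.
   Context: A tournament of order $n$ is an orientation of the complete graph on $n$ vertices; a tournament matrix of order $n$ is its adjacency matrix, i.e. an $n \times n$ $(0,1)$-matrix $M$ with $M + M^T = J_n - I_n$ ($J_n$ all-ones, $I_n$ identity). Tournaments and their matrices are identified. $\mathcal{S}_n$ is the set of singular tournament matrices of order $n$ (over the real/complex numbers). $C_3(M)$ is the number of directed $3$-cycles of $M$, counted as $3$-vertex subsets inducing a directed cycle. A matrix $M \in \mathcal{S}_n$ is a singular maximizer of $C_3$ if $C_3(M) = \max_{N \in \mathcal{S}_n} C_3(N)$. A singular maximizer of $C_3$ of order $n$ is called trivial if it is obtained by adding a vertex (with arbitrary arcs between the new vertex and the old ones) to a regular or almost regular tournament of order $n-1$. A tournament is regular if all its vertices have the same outdegree (its order is then odd); a tournament of order $m$ is almost regular if the maximum difference of outdegrees between its vertices is $1$ (its order $m$ is then even, with $m/2$ vertices of outdegree $m/2-1$ and $m/2$ of outdegree $m/2$). A sink is a vertex beaten by all other vertices; a source is a vertex that beats all other vertices. The strongly connected components of $M$ are the subtournaments induced on the equivalence classes of vertices under the relation "there is a directed walk from $u$ to $v$ and a directed walk from $v$ to $u$". -}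

module Defs where

open import Algebra.Properties.CommutativeMonoid.Sum using (sum)
open import Data.Fin.Base as Fin using (Fin; zero; suc; toℕ; punchIn)
import Data.Fin.Properties as Fin
open import Data.Fin.Subset using (Subset; _∈_; ∣_∣)
open import Data.Integer.Base using (ℤ; 0ℤ; 1ℤ; -1ℤ; _+_; _-_; _*_; _^_)
import Data.Integer.Properties as ℤ
open import Data.List.Base using (List; length; filter; allFin; cartesianProduct)
open import Data.Nat.Base as ℕ using (ℕ; zero; suc)
open import Data.Product.Base using (_×_; _,_; ∃-syntax; Σ-syntax)
open import Data.Sum.Base using (_⊎_)
open import Data.Vec.Functional using (Vector)
open import Function.Bundles using (_⇔_)
open import Relation.Binary.Construct.Closure.ReflexiveTransitive using (Star)
open import Relation.Binary.PropositionalEquality.Core using (_≡_; _≢_)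
open import Relation.Nullary.Decidable.Core using (Dec; yes; no; _×-dec_; _⊎-dec_)

private
  variable
    m n : ℕ

Matrix : ℕ → Set
Matrix n = Vector (Vector ℤ n) n

minor : Matrix (suc n) → Fin (suc n) → Fin (suc n) → Matrix n
minor M i j k l = M (punchIn i k) (punchIn j l)

-- Laplace expansion along the first row.
det : Matrix n → ℤ
det {zero}  M = 1ℤ
det {suc n} M = sum ℤ.+-0-commutativeMonoid
  (λ j → -1ℤ ^ toℕ j * M zero j * det (minor M zero j))

-- The determinant of an integer matrix is the same integer whether computed
-- over ℤ, ℝ or ℂ, so this is singularity over the real or complex numbers.
Singular : Matrix n → Set
Singular M = det M ≡ 0ℤ

allOnes : Matrix n
allOnes i j = 1ℤ

identity : Matrix n
identity i j with i Fin.≟ j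
... | yes _ = 1ℤ
... | no  _ = 0ℤ

record IsTournament (M : Matrix n) : Set where
  field
    zeroOne : ∀ i j → M i j ≡ 0ℤ ⊎ M i j ≡ 1ℤ
    M+Mᵀ    : ∀ i j → M i j + M j i ≡ allOnes i j - identity i j

_∈𝒮 : Matrix n → Set
M ∈𝒮 = IsTournament M × Singular M

Beats : Matrix n → Fin n → Fin n → Set
Beats M i j = M i j ≡ 1ℤ

beats? : ∀ (M : Matrix n) i j → Dec (Beats M i j)
beats? M i j = M i j ℤ.≟ 1ℤ

outdegree : Matrix n → Fin n → ℕ
outdegree {n} M i = length (filter (beats? M i) (allFin n))

DirectedCycle : Matrix n → Fin n → Fin n → Fin n → Set
DirectedCycle M i j k = Beats M i j × Beats M j k × Beats M k i

directedCycle? : ∀ (M : Matrix n) i j k → Dec (DirectedCycle M i j k)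
directedCycle? M i j k = beats? M i j ×-dec beats? M j k ×-dec beats? M k i

-- A 3-vertex subset is represented by its increasing enumeration i < j < k;
-- it induces a directed cycle in one of the two possible senses of rotation.
Cyclic3Subset : Matrix n → Fin n × Fin n × Fin n → Set
Cyclic3Subset M (i , j , k) =
  i Fin.< j × j Fin.< k × (DirectedCycle M i j k ⊎ DirectedCycle M i k j)

cyclic3Subset? : ∀ (M : Matrix n) t → Dec (Cyclic3Subset M t)
cyclic3Subset? M (i , j , k) =
  i Fin.<? j ×-dec j Fin.<? k ×-dec
  (directedCycle? M i j k ⊎-dec directedCycle? M i k j)

triples : ∀ n → List (Fin n × Fin n × Fin n)
triples n = cartesianProduct (allFin n) (cartesianProduct (allFin n) (allFin n))

C₃ : Matrix n → ℕ
C₃ {n} M = length (filter (cyclic3Subset? M) (triples n))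

SingularMaximizer : Matrix n → Set
SingularMaximizer {n} M = M ∈𝒮 × (∀ (N : Matrix n) → N ∈𝒮 → C₃ N ℕ.≤ C₃ M)

Regular : Matrix n → Set
Regular T = IsTournament T × (∀ i j → outdegree T i ≡ outdegree T j)

-- The maximum difference of outdegrees is 1: it is attained and is a bound.
AlmostRegular : Matrix n → Set
AlmostRegular T = IsTournament T
  × (∃[ i ] ∃[ j ] ℕ.∣ outdegree T i - outdegree T j ∣ ≡ 1)
  × (∀ i j → ℕ.∣ outdegree T i - outdegree T j ∣ ℕ.≤ 1)

-- M arises from T by adding a vertex, which receives the label v in M; the
-- vertices of T keep their relative order.  The arcs at v are unconstrained.
AddsVertex : Matrix n → Fin (suc n) → Matrix (suc n) → Set
AddsVertex T v M = ∀ i j → minor M v v i j ≡ T i j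

Source : Matrix n → Fin n → Set
Source M v = ∀ u → u ≢ v → Beats M v u

Sink : Matrix n → Fin n → Set
Sink M v = ∀ u → u ≢ v → Beats M u v

TrivialSingularMaximizer : Matrix (suc m) → Set
TrivialSingularMaximizer {m} M = SingularMaximizer M
  × Σ[ T ∈ Matrix m ] ((Regular T ⊎ AlmostRegular T) × ∃[ v ] AddsVertex T v M)

AddsSourceOrSink : Matrix (suc m) → Set
AddsSourceOrSink {m} M =
  Σ[ T ∈ Matrix m ] ((Regular T ⊎ AlmostRegular T)
    × ∃[ v ] (AddsVertex T v M × (Source M v ⊎ Sink M v)))

Walk : Matrix n → Fin n → Fin n → Set
Walk M = Star (Beats M)

MutuallyReachable : Matrix n → Fin n → Fin n → Set
MutuallyReachable M u v = Walk M u v × Walk M v u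

-- S is the vertex set of a strongly connected component: an equivalence class
-- of mutual reachability.
IsStrongComponent : Matrix n → Subset n → Set
IsStrongComponent M S = ∃[ u ] (∀ v → v ∈ S ⇔ MutuallyReachable M u v)

HasStrongComponentOfOrder : ℕ → Matrix n → Set
HasStrongComponentOfOrder k M = ∃[ S ] (IsStrongComponent M S × ∣ S ∣ ≡ k)

{-# OPTIONS --safe #-}

-- Write S = M - Mᵀ, let Dᵢ = ∑ⱼ Sᵢⱼ be the outdegree minus the indegree of i, and let
-- the energy of M be E(M) = ∑ᵢ Dᵢ².
-- Counting the transitive triples gives 8 C₃(M) + E(M) = const(n), so maximizing C₃
-- is minimizing E.  A nonzero y with yᵀM = 0 yields E(M) ≥ n(n - 1) for singular M.
-- Deleting a vertex v that lies on no 3-cycle lowers the energy by a constant that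
-- depends only on n.  Comparing with a sink added to a (nearly) regular tournament, if
-- M is a singular maximizer then M - v has minimal energy, that is, it is regular or
-- almost regular; this applies to a strong component {v} and to a source or sink v.
-- Conversely, if M - v is regular or almost regular and v is neither a source nor a
-- sink, then E(M) < n(n - 1), unless n ≤ 4, where M has a source or sink anyway.
module Submission where

open import Data.Bool.Base using (true; false; if_then_else_)
open import Data.Empty using (⊥; ⊥-elim)
open import Data.Fin.Base as Fin using (Fin; zero; suc; toℕ; punchIn; punchOut; inject₁)
import Data.Fin.Properties as Fin
open import Data.Fin.Subset using (Subset; _∈_; ∣_∣; ⁅_⁆)
open import Data.Fin.Subset.Properties using (x∈⁅x⁆; x∈⁅y⁆⇒x≡y; ∣⁅x⁆∣≡1; x∈p⇒∣p-x∣<∣p∣; x∈p∧x≢y⇒x∈p-y)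
open import Data.Integer.Base hiding (suc; ∣_∣)
import Data.Integer.Properties as ℤ
open import Data.Integer.Tactic.RingSolver using (solve-∀)
open import Data.List.Base using ([]; _∷_; _++_; map; length; filter; tabulate; allFin; cartesianProduct)
open import Data.List.Properties using (length-++; filter-++)
open import Data.Nat.Base as ℕ using (ℕ; zero; suc)
import Data.Nat.Properties as ℕ
open import Data.Product.Base using (_×_; _,_; ∃-syntax; Σ-syntax; proj₁; proj₂)
open import Data.Sum.Base using (_⊎_; inj₁; inj₂; [_,_]′)
open import Defs
open import Function.Base using (_∘_)
open import Function.Bundles using (_⇔_; mk⇔; Equivalence)
open import Relation.Binary.Construct.Closure.ReflexiveTransitive using (ε; _◅_)
open import Relation.Binary.PropositionalEquality
open import Relation.Nullary.Decidable using (dec-false)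
open import Relation.Nullary.Decidable.Core using (Dec; does; yes; no; _×-dec_; _⊎-dec_)
open import Relation.Nullary.Negation using (contradiction; ¬_)
open import Relation.Unary using (Decidable)
open import Algebra.Properties.Semiring.Sum ℤ.+-*-semiring
open ≡-Reasoning

-- Singularity of M enters through a nonzero integer vector y with yᵀM = 0. As `det` is a Laplace
-- expansion along the first row over ℤ, the vector comes from fraction-free operations on adjacent
-- columns: two equal adjacent columns give two cancelling terms, so no permutation signs have to be
-- tracked.
--
-- The final inequality comes from a correlation bound. Put N = n - 1, let r be the ±1 vector of
-- arcs at v, R = ∑ r, and D the imbalances of M - v. Then E(M) = R² + ∑ D² - 2 ∑ rD + N. If M - v
-- is regular or almost regular, |D| ≤ 1, so ∑ D² ≤ N, and ∑ (1 - r)(1 - D) ≥ 0 with ∑ D = 0 gives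
-- -∑ rD ≤ N - R. For N ≥ 4 and 0 ≤ R < N this keeps E(M) below N² + N = n(n - 1). Reversing all
-- arcs covers R < 0.
--
-- In order at most 4 the source or sink found may differ from the vertex v that was added. The
-- tournament left after its deletion is then a new one, and maximality has to be used once more to
-- see that it is regular or almost regular.

private
  variable
    m n : ℕ

-- Determinants and null vectors

∑-linear : ∀ (a b : ℤ) (f g : Fin n → ℤ) →
  ∑[ i < n ] (a * f i + b * g i) ≡ a * sum f + b * sum g
∑-linear a b f g = trans (∑-distrib-+ (λ i → a * f i) (λ i → b * g i))
  (sym (cong₂ _+_ (*-distribˡ-sum a f) (*-distribˡ-sum b g)))

∑-zero : (f : Fin n → ℤ) → (∀ i → f i ≡ 0ℤ) → sum f ≡ 0ℤ
∑-zero {n} f f≡0 = trans (sum-cong-≗ f≡0) (sum-replicate-zero n)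

laplaceTerm : Matrix (suc n) → Fin (suc n) → ℤ
laplaceTerm M j = -1ℤ ^ toℕ j * M zero j * det (minor M zero j)

det-cong : {A B : Matrix n} → (∀ i j → A i j ≡ B i j) → det A ≡ det B
det-cong {zero}  A≡B = refl
det-cong {suc n} A≡B = sum-cong-≗ λ j →
  cong₂ _*_ (cong (-1ℤ ^ toℕ j *_) (A≡B zero j))
            (det-cong λ k l → A≡B (suc k) (punchIn j l))

-- Induction along the Laplace expansion: in the term j = k only the entry depends on column k, in
-- every other term only the minor does, with column k at position `punchOut j≢k`.
det-column-linear : ∀ (A B C : Matrix n) k a b →
  (∀ i → C i k ≡ a * A i k + b * B i k) →
  (∀ i l → l ≢ k → C i l ≡ A i l) →
  (∀ i l → l ≢ k → C i l ≡ B i l) →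
  det C ≡ a * det A + b * det B
det-column-linear {suc n} A B C k a b Ck C≡A C≡B =
  trans (sum-cong-≗ term) (∑-linear a b (laplaceTerm A) (laplaceTerm B))
  where
  distrib₁ : ∀ a b s x y d → s * (a * x + b * y) * d ≡ a * (s * x * d) + b * (s * y * d)
  distrib₁ = solve-∀

  distrib₂ : ∀ a b t x y → t * (a * x + b * y) ≡ a * (t * x) + b * (t * y)
  distrib₂ = solve-∀

  term : ∀ j → laplaceTerm C j ≡ a * laplaceTerm A j + b * laplaceTerm B j
  term j with j Fin.≟ k
  ... | yes refl
    rewrite Ck zero
          | sym (det-cong {A = minor C zero j} λ i l → C≡A (suc i) _ (Fin.punchInᵢ≢i j l))
          | sym (det-cong {A = minor C zero j} λ i l → C≡B (suc i) _ (Fin.punchInᵢ≢i j l))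
    = distrib₁ a b (-1ℤ ^ toℕ j) (A zero j) (B zero j) (det (minor C zero j))
  ... | no j≢k
    rewrite sym (C≡A zero j j≢k) | sym (C≡B zero j j≢k)
    = trans (cong (-1ℤ ^ toℕ j * C zero j *_) minors)
            (distrib₂ a b (-1ℤ ^ toℕ j * C zero j) _ _)
    where
    k′ = punchOut j≢k
    ≢k : ∀ l → l ≢ k′ → punchIn j l ≢ k
    ≢k l l≢k′ e =
      l≢k′ (Fin.punchIn-injective j l k′ (trans e (sym (Fin.punchIn-punchOut j≢k))))
    minors : det (minor C zero j) ≡ a * det (minor A zero j) + b * det (minor B zero j)
    minors = det-column-linear _ _ _ k′ a b
      (λ i → subst (λ c → C (suc i) c ≡ a * A (suc i) c + b * B (suc i) c)
               (sym (Fin.punchIn-punchOut j≢k)) (Ck (suc i)))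
      (λ i l l≢ → C≡A (suc i) _ (≢k l l≢))
      (λ i l l≢ → C≡B (suc i) _ (≢k l l≢))

∑-adjacent-cancel : ∀ (f : Fin (suc n) → ℤ) (k : Fin n) →
  (∀ j → j ≢ inject₁ k → j ≢ suc k → f j ≡ 0ℤ) →
  f (inject₁ k) + f (suc k) ≡ 0ℤ → sum f ≡ 0ℤ
∑-adjacent-cancel {suc n} f zero f≡0 cancel = begin
  f zero + (f (suc zero) + sum rest)  ≡⟨ ℤ.+-assoc (f zero) _ _ ⟨
  f zero + f (suc zero) + sum rest    ≡⟨ cong₂ _+_ cancel (∑-zero rest λ j → f≡0 (suc (suc j)) (λ ()) (λ ())) ⟩
  0ℤ                                  ∎
  where rest = λ j → f (suc (suc j))
∑-adjacent-cancel f (suc k) f≡0 cancel = cong₂ _+_ (f≡0 zero (λ ()) (λ ()))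
  (∑-adjacent-cancel (f ∘ suc) k
    (λ j j≢k j≢k+1 → f≡0 (suc j) (j≢k ∘ Fin.suc-injective) (j≢k+1 ∘ Fin.suc-injective)) cancel)

-- Deleting a third column keeps two neighbours adjacent, so induction on the order can use adjacent
-- columns alone.
punchIn-adjacent : ∀ (j : Fin (suc (suc n))) (k : Fin (suc n)) →
  j ≢ inject₁ k → j ≢ suc k →
  ∃[ k′ ] (punchIn j (inject₁ k′) ≡ inject₁ k × punchIn j (suc k′) ≡ suc k)
punchIn-adjacent zero          zero    j≢k j≢k+1 = contradiction refl j≢k
punchIn-adjacent zero          (suc k) j≢k j≢k+1 = k , refl , refl
punchIn-adjacent (suc zero)    zero    j≢k j≢k+1 = contradiction refl j≢k+1
punchIn-adjacent {suc n} (suc (suc j)) zero j≢k j≢k+1 = zero , refl , refl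
punchIn-adjacent {suc n} (suc j) (suc k) j≢k j≢k+1
  with k′ , e , e′ ← punchIn-adjacent j k (j≢k ∘ cong suc) (j≢k+1 ∘ cong suc)
  = suc k′ , cong suc e , cong suc e′

-- The minors without column k and without column k + 1 differ only in which of these two columns
-- survives, and it survives in the same place.
punchIn-inject₁-suc : ∀ (k l : Fin n) →
  punchIn (inject₁ k) l ≡ punchIn (suc k) l
  ⊎ (punchIn (inject₁ k) l ≡ suc k × punchIn (suc k) l ≡ inject₁ k)
punchIn-inject₁-suc zero    zero    = inj₂ (refl , refl)
punchIn-inject₁-suc zero    (suc l) = inj₁ refl
punchIn-inject₁-suc (suc k) zero    = inj₁ refl
punchIn-inject₁-suc (suc k) (suc l) with punchIn-inject₁-suc k l
... | inj₁ e        = inj₁ (cong suc e)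
... | inj₂ (e , e′) = inj₂ (cong suc e , cong suc e′)

-- Every minor that keeps both columns vanishes by induction. The two remaining terms have equal
-- entries and equal minors, and their signs are consecutive powers of -1.
det-adjacent-columns-equal : ∀ (A : Matrix (suc n)) (k : Fin n) →
  (∀ i → A i (inject₁ k) ≡ A i (suc k)) → det A ≡ 0ℤ
det-adjacent-columns-equal {suc n} A k equal = ∑-adjacent-cancel (laplaceTerm A) k others pair
  where
  others : ∀ j → j ≢ inject₁ k → j ≢ suc k → laplaceTerm A j ≡ 0ℤ
  others j j≢k j≢k+1 with k′ , e , e′ ← punchIn-adjacent j k j≢k j≢k+1 =
    trans (cong (-1ℤ ^ toℕ j * A zero j *_)
            (det-adjacent-columns-equal (minor A zero j) k′ λ i →
              trans (cong (A (suc i)) e) (trans (equal (suc i)) (cong (A (suc i)) (sym e′)))))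
          (ℤ.*-zeroʳ (-1ℤ ^ toℕ j * A zero j))

  minors : ∀ i l → minor A zero (inject₁ k) i l ≡ minor A zero (suc k) i l
  minors i l with punchIn-inject₁-suc k l
  ... | inj₁ e        = cong (A (suc i)) e
  ... | inj₂ (e , e′) = trans (cong (A (suc i)) e)
                          (trans (sym (equal (suc i))) (cong (A (suc i)) (sym e′)))

  opposite : ∀ s x d → s * x * d + -1ℤ * s * x * d ≡ 0ℤ
  opposite = solve-∀

  pair : laplaceTerm A (inject₁ k) + laplaceTerm A (suc k) ≡ 0ℤ
  pair rewrite Fin.toℕ-inject₁ k | equal zero | det-cong minors =
    opposite (-1ℤ ^ toℕ k) (A zero (suc k)) (det (minor A zero (suc k)))

-- Elimination by adjacent column operations

LeftNull : (Fin n → ℤ) → Matrix n → Set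
LeftNull {n} y M = ∀ j → ∑[ i < n ] (y i * M i j) ≡ 0ℤ

combineColumns : ℤ → ℤ → Fin n → Fin n → Matrix n → Matrix n
combineColumns a b k k′ M i l with l Fin.≟ k
... | yes _ = a * M i k + b * M i k′
... | no  _ = M i l

module _ (a b : ℤ) (k k′ : Fin n) (M : Matrix n) where

  combineColumns-at : ∀ i → combineColumns a b k k′ M i k ≡ a * M i k + b * M i k′
  combineColumns-at i with k Fin.≟ k
  ... | yes _   = refl
  ... | no  k≢k = contradiction refl k≢k

  combineColumns-off : ∀ i l → l ≢ k → combineColumns a b k k′ M i l ≡ M i l
  combineColumns-off i l l≢k with l Fin.≟ k
  ... | yes l≡k = contradiction l≡k l≢k
  ... | no  _   = refl

data Adjacent {n} : Fin (suc n) → Fin (suc n) → Set where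
  rightward : ∀ k → Adjacent (inject₁ k) (suc k)
  leftward  : ∀ k → Adjacent (suc k) (inject₁ k)

inject₁≢suc : ∀ (k : Fin n) → inject₁ k ≢ suc k
inject₁≢suc zero    ()
inject₁≢suc (suc k) = inject₁≢suc k ∘ Fin.suc-injective

adjacent⇒≢ : ∀ {k k′ : Fin (suc n)} → Adjacent k k′ → k ≢ k′
adjacent⇒≢ (rightward k) = inject₁≢suc k
adjacent⇒≢ (leftward k)  = inject₁≢suc k ∘ sym

det-combineColumns : ∀ a b {k k′} → Adjacent k k′ → (M : Matrix (suc n)) →
  det (combineColumns a b k k′ M) ≡ a * det M
det-combineColumns a b {k} {k′} adj M = begin
  det (combineColumns a b k k′ M)  ≡⟨ det-column-linear M B (combineColumns a b k k′ M) k a b at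
                                        (combineColumns-off a b k k′ M)
                                        (λ i l l≢k → trans (combineColumns-off a b k k′ M i l l≢k)
                                                           (sym (combineColumns-off 0ℤ 1ℤ k k′ M i l l≢k))) ⟩
  a * det M + b * det B            ≡⟨ cong (λ d → a * det M + b * d) (detB adj same) ⟩
  a * det M + b * 0ℤ               ≡⟨ drop (a * det M) b ⟩
  a * det M                        ∎
  where
  -- `B` is `M` with column k overwritten by its neighbour k′; the combined matrix is then linear in
  -- column k between `M` and `B`.
  B = combineColumns 0ℤ 1ℤ k k′ M

  drop : ∀ x b → x + b * 0ℤ ≡ x
  drop = solve-∀

  select : ∀ x y → 0ℤ * x + 1ℤ * y ≡ y
  select = solve-∀

  B-at : ∀ i → B i k ≡ M i k′
  B-at i = trans (combineColumns-at 0ℤ 1ℤ k k′ M i) (select (M i k) (M i k′))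

  at : ∀ i → combineColumns a b k k′ M i k ≡ a * M i k + b * B i k
  at i = trans (combineColumns-at a b k k′ M i)
               (cong (λ x → a * M i k + b * x) (sym (B-at i)))

  same : ∀ i → B i k ≡ B i k′
  same i = trans (B-at i) (sym (combineColumns-off 0ℤ 1ℤ k k′ M i k′ (adjacent⇒≢ adj ∘ sym)))

  detB : ∀ {k k′} → Adjacent k k′ → (∀ i → B i k ≡ B i k′) → det B ≡ 0ℤ
  detB (rightward k) same = det-adjacent-columns-equal B k same
  detB (leftward k)  same = det-adjacent-columns-equal B k (sym ∘ same)

≢0∧*≡0⇒≡0 : ∀ a b → a ≢ 0ℤ → a * b ≡ 0ℤ → b ≡ 0ℤ
≢0∧*≡0⇒≡0 a b a≢0 ab≡0 with ℤ.i*j≡0⇒i≡0∨j≡0 a ab≡0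
... | inj₁ a≡0 = contradiction a≡0 a≢0
... | inj₂ b≡0 = b≡0

-- Column k′ is unchanged, so y annihilates it; what remains of the combined column is a times the
-- product with column k, and a can be cancelled.
leftNull-combineColumns : ∀ a b {k k′ : Fin n} → a ≢ 0ℤ → k ≢ k′ → ∀ M y →
  LeftNull y (combineColumns a b k k′ M) → LeftNull y M
leftNull-combineColumns {n} a b {k} {k′} a≢0 k≢k′ M y null l with l Fin.≟ k
... | no l≢k = trans
  (sum-cong-≗ λ i → cong (y i *_) (sym (combineColumns-off a b k k′ M i l l≢k))) (null l)
... | yes refl = ≢0∧*≡0⇒≡0 a _ a≢0 (begin
  a * yMₖ                                        ≡⟨ pad (a * yMₖ) b ⟩
  a * yMₖ + b * 0ℤ                               ≡⟨ cong (λ x → a * yMₖ + b * x) yMₖ′ ⟨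
  a * yMₖ + b * ∑[ i < n ] (y i * M i k′)        ≡⟨ ∑-linear a b (λ i → y i * M i k) (λ i → y i * M i k′) ⟨
  ∑[ i < n ] (a * (y i * M i k) + b * (y i * M i k′))  ≡⟨ sum-cong-≗ term ⟩
  ∑[ i < n ] (y i * combineColumns a b k k′ M i k)     ≡⟨ null k ⟩
  0ℤ                                             ∎)
  where
  yMₖ = ∑[ i < n ] (y i * M i k)

  pad : ∀ x b → x ≡ x + b * 0ℤ
  pad = solve-∀

  yMₖ′ : ∑[ i < n ] (y i * M i k′) ≡ 0ℤ
  yMₖ′ = trans
    (sum-cong-≗ λ i → cong (y i *_) (sym (combineColumns-off a b k k′ M i k′ (k≢k′ ∘ sym)))) (null k′)

  distrib : ∀ a b y u v → a * (y * u) + b * (y * v) ≡ y * (a * u + b * v)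
  distrib = solve-∀

  term : ∀ i → a * (y i * M i k) + b * (y i * M i k′) ≡ y i * combineColumns a b k k′ M i k
  term i = trans (distrib a b (y i) (M i k) (M i k′))
                 (cong (y i *_) (sym (combineColumns-at a b k k′ M i)))

-- The two properties travel in opposite directions: singularity goes forward to the reduced matrix,
-- the null vector found there comes back.
record _⇝_ (M M′ : Matrix n) : Set where
  field
    singular : Singular M → Singular M′
    leftNull : ∀ y → LeftNull y M′ → LeftNull y M

open _⇝_

⇝-refl : {M : Matrix n} → M ⇝ M
⇝-refl = record { singular = λ s → s ; leftNull = λ y null → null }

⇝-trans : {L M N : Matrix n} → L ⇝ M → M ⇝ N → L ⇝ N
⇝-trans p q = record
  { singular = singular q ∘ singular p
  ; leftNull = λ y → leftNull p y ∘ leftNull q y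
  }

⇝-combineColumns : ∀ a b {k k′} → a ≢ 0ℤ → Adjacent k k′ → (M : Matrix (suc n)) →
  M ⇝ combineColumns a b k k′ M
⇝-combineColumns a b a≢0 adj M = record
  { singular = λ s → trans (det-combineColumns a b adj M)
                           (trans (cong (a *_) s) (ℤ.*-zeroʳ a))
  ; leftNull = leftNull-combineColumns a b a≢0 (adjacent⇒≢ adj) M
  }

ClearsEntry : Fin n → Matrix (suc n) → Set
ClearsEntry {n} k M = Σ[ M′ ∈ Matrix (suc n) ] (M ⇝ M′ × M′ zero (suc k) ≡ 0ℤ
  × (∀ l → l ≢ inject₁ k → l ≢ suc k → M′ zero l ≡ M zero l))

-- Cross-multiplication replaces division: p q - q p = 0, and the factor p ≠ 0 keeps the operation
-- reversible for null vectors.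
clearEntry-pivot : ∀ (k : Fin n) M → M zero (inject₁ k) ≢ 0ℤ → ClearsEntry k M
clearEntry-pivot k M p≢0 =
  combineColumns p (- q) (suc k) (inject₁ k) M ,
  ⇝-combineColumns p (- q) p≢0 (leftward k) M ,
  trans (combineColumns-at p (- q) (suc k) (inject₁ k) M zero) (cancel p q) ,
  λ l _ l≢suc → combineColumns-off p (- q) (suc k) (inject₁ k) M zero l l≢suc
  where
  p = M zero (inject₁ k)
  q = M zero (suc k)
  cancel : ∀ p q → p * q + - q * p ≡ 0ℤ
  cancel = solve-∀

clearEntry : ∀ (k : Fin n) M → ClearsEntry k M
clearEntry k M with M zero (suc k) ℤ.≟ 0ℤ | M zero (inject₁ k) ℤ.≟ 0ℤ
... | yes q≡0 | _       = M , ⇝-refl , q≡0 , λ _ _ _ → refl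
... | no  q≢0 | no  p≢0 = clearEntry-pivot k M p≢0
-- With a zero pivot, adding the right column to the left one first turns the pivot into q.
... | no  q≢0 | yes p≡0 =
  let M″ , M′⇝M″ , cleared , unchanged = clearEntry-pivot k M′ (q≢0 ∘ trans (sym M′-at))
  in M″ , ⇝-trans (⇝-combineColumns 1ℤ 1ℤ (λ ()) (rightward k) M) M′⇝M″ , cleared ,
     λ l l≢k l≢k+1 → trans (unchanged l l≢k l≢k+1)
                           (combineColumns-off 1ℤ 1ℤ (inject₁ k) (suc k) M zero l l≢k)
  where
  M′ = combineColumns 1ℤ 1ℤ (inject₁ k) (suc k) M
  units : ∀ q → 1ℤ * 0ℤ + 1ℤ * q ≡ q
  units = solve-∀
  M′-at : M′ zero (inject₁ k) ≡ M zero (suc k)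
  M′-at = trans (combineColumns-at 1ℤ 1ℤ (inject₁ k) (suc k) M zero)
    (trans (cong (λ p → 1ℤ * p + 1ℤ * M zero (suc k)) p≡0) (units (M zero (suc k))))

-- Entries are cleared from the right, each against its left neighbour: this may change the
-- neighbour, which is treated later, but no entry already cleared. `d` counts the entries to clear.
clearFirstRow : ∀ c d → c ℕ.+ d ≡ n → (M : Matrix (suc n)) →
  Σ[ M′ ∈ Matrix (suc n) ] (M ⇝ M′ × (∀ l → c ℕ.< toℕ l → M′ zero l ≡ 0ℤ))
clearFirstRow c zero c≡n M = M , ⇝-refl , λ l c<l →
  contradiction (ℕ.≤-trans c<l (ℕ.≤-pred (Fin.toℕ<n l)))
                (ℕ.<-irrefl (trans (sym (ℕ.+-identityʳ c)) c≡n))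
clearFirstRow {n} c (suc d) c+1+d≡n M =
  let M₁ , M⇝M₁ , zeros                = clearFirstRow (suc c) d (trans (sym (ℕ.+-suc c d)) c+1+d≡n) M
      M₂ , M₁⇝M₂ , cleared , unchanged = clearEntry k M₁
  in M₂ , ⇝-trans M⇝M₁ M₁⇝M₂ , extend M₁ M₂ zeros cleared unchanged
  where
  c<n : c ℕ.< n
  c<n = subst (c ℕ.<_) c+1+d≡n (ℕ.m<m+n c (ℕ.s≤s ℕ.z≤n))
  k = Fin.fromℕ< c<n
  extend : ∀ M₁ M₂ → (∀ l → suc c ℕ.< toℕ l → M₁ zero l ≡ 0ℤ) → M₂ zero (suc k) ≡ 0ℤ →
    (∀ l → l ≢ inject₁ k → l ≢ suc k → M₂ zero l ≡ M₁ zero l) →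
    ∀ l → c ℕ.< toℕ l → M₂ zero l ≡ 0ℤ
  extend M₁ M₂ zeros cleared unchanged l c<l with l Fin.≟ suc k
  ... | yes refl   = cleared
  ... | no  l≢k+1 = trans (unchanged l l≢k l≢k+1) (zeros l (ℕ.≤∧≢⇒< c<l c+1≢l))
    where
    l≢k : l ≢ inject₁ k
    l≢k refl = ℕ.<-irrefl (sym (trans (Fin.toℕ-inject₁ k) (Fin.toℕ-fromℕ< c<n))) c<l
    c+1≢l : suc c ≢ toℕ l
    c+1≢l e = l≢k+1 (Fin.toℕ-injective (trans (sym e) (cong suc (sym (Fin.toℕ-fromℕ< c<n)))))

det-cleared : (M : Matrix (suc n)) → (∀ j → M zero (suc j) ≡ 0ℤ) →
  det M ≡ M zero zero * det (minor M zero zero)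
det-cleared M zeros = trans (cong (_+_ (laplaceTerm M zero)) (∑-zero (laplaceTerm M ∘ suc) rest))
                            (first (M zero zero) (det (minor M zero zero)))
  where
  first : ∀ p d → 1ℤ * p * d + 0ℤ ≡ p * d
  first = solve-∀
  vanish : ∀ s d → s * 0ℤ * d ≡ 0ℤ
  vanish = solve-∀
  rest : ∀ j → laplaceTerm M (suc j) ≡ 0ℤ
  rest j = trans (cong (λ x → -1ℤ ^ toℕ (suc j) * x * det (minor M zero (suc j))) (zeros j))
                 (vanish (-1ℤ ^ toℕ (suc j)) (det (minor M zero (suc j))))

-- Adjacent column operations do not change the vectors y with yᵀM = 0 and bring
-- the first row to the form (p , 0 , … , 0).
singular⇒leftNull : (M : Matrix n) → Singular M →
  Σ[ y ∈ (Fin n → ℤ) ] ((∃[ i ] y i ≢ 0ℤ) × LeftNull y M)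
singular⇒leftNull {suc n} M detM≡0
  with M′ , M⇝M′ , zeros ← clearFirstRow 0 n refl M
  with M′ zero zero ℤ.≟ 0ℤ
... | yes p≡0 = y , (zero , λ ()) , leftNull M⇝M′ y null
  where
  y : Fin (suc n) → ℤ
  y zero    = 1ℤ
  y (suc i) = 0ℤ
  row : ∀ j → M′ zero j ≡ 0ℤ
  row zero    = p≡0
  row (suc j) = zeros (suc j) (ℕ.s≤s ℕ.z≤n)
  null : LeftNull y M′
  null j = cong₂ _+_ (cong (1ℤ *_) (row j))
                     (∑-zero (λ i → 0ℤ * M′ (suc i) j) λ i → ℤ.*-zeroˡ (M′ (suc i) j))
... | no p≢0
  with y , (i , yᵢ≢0) , null ← singular⇒leftNull (minor M′ zero zero)
    (≢0∧*≡0⇒≡0 (M′ zero zero) (det (minor M′ zero zero)) p≢0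
      (trans (sym (det-cleared M′ λ j → zeros (suc j) (ℕ.s≤s ℕ.z≤n))) (singular M⇝M′ detM≡0)))
  = x , (suc i , λ e → yᵢ≢0 (≢0∧*≡0⇒≡0 p (y i) p≢0 e)) , leftNull M⇝M′ x xnull
  where
  p = M′ zero zero
  y·M : Fin (suc n) → ℤ
  y·M j = ∑[ k < n ] (y k * M′ (suc k) j)
  -- In column 0 the lower rows contribute p times `y·M zero` once y is scaled by p, so the first
  -- coordinate balances them without a division. The other columns have first entry 0.
  x : Fin (suc n) → ℤ
  x zero    = - y·M zero
  x (suc k) = p * y k
  scaled : ∀ j → ∑[ k < n ] (p * y k * M′ (suc k) j) ≡ p * y·M j
  scaled j = trans (sum-cong-≗ λ k → ℤ.*-assoc p (y k) (M′ (suc k) j))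
                   (sym (*-distribˡ-sum p λ k → y k * M′ (suc k) j))
  cancel : ∀ s p → - s * p + p * s ≡ 0ℤ
  cancel = solve-∀
  kill : ∀ s p → s * 0ℤ + p * 0ℤ ≡ 0ℤ
  kill = solve-∀
  xnull : LeftNull x M′
  xnull zero    = trans (cong (_+_ (- y·M zero * p)) (scaled zero)) (cancel (y·M zero) p)
  xnull (suc j) = trans (cong₂ _+_ (cong (- y·M zero *_) (zeros (suc j) (ℕ.s≤s ℕ.z≤n)))
                                   (trans (scaled (suc j)) (cong (p *_) (null j))))
                        (kill (- y·M zero) p)

-- Sums of integers

-- The format of the inequalities below: a nonnegative certificate c, and a ring identity left to
-- the solver.
≤-from-difference : ∀ {a b c} → 0ℤ ≤ c → b - a ≡ c → a ≤ b
≤-from-difference 0≤c b-a≡c = ℤ.0≤i-j⇒j≤i (subst (0ℤ ≤_) (sym b-a≡c) 0≤c)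

square-nonNeg : ∀ a → 0ℤ ≤ a * a
square-nonNeg (+ a)    = subst (0ℤ ≤_) (ℤ.pos-* a a) (+≤+ ℕ.z≤n)
square-nonNeg -[1+ a ] = +≤+ ℕ.z≤n

square≡0 : ∀ a → a * a ≡ 0ℤ → a ≡ 0ℤ
square≡0 a a²≡0 with ℤ.i*j≡0⇒i≡0∨j≡0 a a²≡0
... | inj₁ a≡0 = a≡0
... | inj₂ a≡0 = a≡0

a≡-a⇒a≡0 : ∀ a → a ≡ - a → a ≡ 0ℤ
a≡-a⇒a≡0 (+ zero) _ = refl

∑-linear₃ : ∀ (a b c : ℤ) (f g h : Fin n → ℤ) →
  ∑[ i < n ] (a * f i + b * g i + c * h i) ≡ a * sum f + b * sum g + c * sum h
∑-linear₃ a b c f g h = trans (∑-distrib-+ (λ i → a * f i + b * g i) (λ i → c * h i))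
  (cong₂ _+_ (∑-linear a b f g) (sym (*-distribˡ-sum c h)))

∑-one : ∀ n → ∑[ i < n ] 1ℤ ≡ + n
∑-one zero    = refl
∑-one (suc n) = cong (_+_ 1ℤ) (∑-one n)

∑-mono-≤ : {f g : Fin n → ℤ} → (∀ i → f i ≤ g i) → sum f ≤ sum g
∑-mono-≤ {zero}  f≤g = ℤ.≤-refl
∑-mono-≤ {suc n} f≤g = ℤ.+-mono-≤ (f≤g zero) (∑-mono-≤ (f≤g ∘ suc))

∑-nonNeg : {f : Fin n → ℤ} → (∀ i → 0ℤ ≤ f i) → 0ℤ ≤ sum f
∑-nonNeg {n} 0≤f = ℤ.≤-trans (ℤ.≤-reflexive (sym (sum-replicate-zero n))) (∑-mono-≤ 0≤f)

∑-nonNeg-zero : (f : Fin n → ℤ) → (∀ i → 0ℤ ≤ f i) → sum f ≤ 0ℤ → ∀ i → f i ≡ 0ℤ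
∑-nonNeg-zero {suc n} f 0≤f ∑f≤0 i = ℤ.≤-antisym
  (ℤ.≤-trans (ℤ.i≤i+j (f i) (∑[ k < n ] f (punchIn i k))
               {{nonNegative (∑-nonNeg λ k → 0≤f (punchIn i k))}})
             (subst (_≤ 0ℤ) (sum-remove f) ∑f≤0))
  (0≤f i)

∑-neg : (f : Fin n → ℤ) → ∑[ i < n ] (- f i) ≡ - sum f
∑-neg f = trans (sum-cong-≗ λ i → sym (ℤ.-1*i≡-i (f i)))
                (trans (sym (*-distribˡ-sum -1ℤ f)) (ℤ.-1*i≡-i (sum f)))

∑∑-antisymmetric : (f : Fin n → Fin n → ℤ) → (∀ i j → f i j ≡ - f j i) →
  ∑[ i < n ] ∑[ j < n ] f i j ≡ 0ℤ
∑∑-antisymmetric {n} f anti = a≡-a⇒a≡0 _ (begin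
  ∑[ i < n ] ∑[ j < n ] f i j      ≡⟨ sum-cong-≗ (λ i → trans (sum-cong-≗ (anti i)) (∑-neg (λ j → f j i))) ⟩
  ∑[ i < n ] (- ∑[ j < n ] f j i)  ≡⟨ ∑-neg (λ i → ∑[ j < n ] f j i) ⟩
  - (∑[ i < n ] ∑[ j < n ] f j i)  ≡⟨ cong -_ (∑-comm (λ i j → f j i)) ⟩
  - (∑[ i < n ] ∑[ j < n ] f i j)  ∎)

identity-diagonal : ∀ (i : Fin n) → identity i i ≡ 1ℤ
identity-diagonal i with i Fin.≟ i
... | yes _   = refl
... | no  i≢i = contradiction refl i≢i

identity-off : ∀ (i j : Fin n) → i ≢ j → identity i j ≡ 0ℤ
identity-off i j i≢j with i Fin.≟ j
... | yes i≡j = contradiction i≡j i≢j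
... | no  _   = refl

∑-identity : ∀ (f : Fin n → ℤ) j → ∑[ i < n ] (f i * identity i j) ≡ f j
∑-identity {suc n} f j = begin
  ∑[ i < suc n ] (f i * identity i j)  ≡⟨ sum-remove (λ i → f i * identity i j) ⟩
  f j * identity j j + ∑[ k < n ] (f (punchIn j k) * identity (punchIn j k) j)
    ≡⟨ cong₂ _+_ (trans (cong (f j *_) (identity-diagonal j)) (ℤ.*-identityʳ (f j)))
                 (∑-zero (λ k → f (punchIn j k) * identity (punchIn j k) j) λ k →
                   trans (cong (f (punchIn j k) *_) (identity-off (punchIn j k) j (Fin.punchInᵢ≢i j k)))
                         (ℤ.*-zeroʳ (f (punchIn j k)))) ⟩
  f j + 0ℤ                             ≡⟨ ℤ.+-identityʳ (f j) ⟩
  f j                                  ∎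

-- Imbalances of singular tournaments

skew : Matrix n → Fin n → Fin n → ℤ
skew M i j = M i j - M j i

imbalance : Matrix n → Fin n → ℤ
imbalance {n} M i = ∑[ j < n ] skew M i j

energy : Matrix n → ℤ
energy {n} M = ∑[ i < n ] (imbalance M i * imbalance M i)

skew-antisymmetric : ∀ (M : Matrix n) i j → skew M i j ≡ - skew M j i
skew-antisymmetric M i j = swap (M i j) (M j i)
  where
  swap : ∀ a b → a - b ≡ - (b - a)
  swap = solve-∀

∑-imbalance : (M : Matrix n) → sum (imbalance M) ≡ 0ℤ
∑-imbalance M = ∑∑-antisymmetric (skew M) (skew-antisymmetric M)

skew-entry : {M : Matrix n} → IsTournament M → ∀ i j →
  skew M i j ≡ M i j + M i j - (1ℤ - identity i j)
skew-entry {M = M} T i j = trans (rearrange (M i j) (M j i))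
  (cong (λ x → M i j + M i j - x) (IsTournament.M+Mᵀ T i j))
  where
  rearrange : ∀ a b → a - b ≡ a + a - (a + b)
  rearrange = solve-∀

-- For yᵀM = 0 with σ = ∑ y, the skew part satisfies yᵀS = yᵀ - σ1ᵀ.  Hence ∑ y² = σ²
-- and ∑ y D = (1 - n)σ, and the bound is ∑ (n yᵢ - σ + σ Dᵢ)² ≥ 0.
singular⇒energy≥ : {M : Matrix n} → IsTournament M → Singular M →
  + n * (+ n - 1ℤ) ≤ energy M
singular⇒energy≥ {n} {M} T detM≡0
  with y , (i₀ , y≢0) , null ← singular⇒leftNull M detM≡0
  = ℤ.*-cancelˡ-≤-pos (+ n * (+ n - 1ℤ)) (energy M) (σ * σ)
      {{positive (ℤ.≤∧≢⇒< (square-nonNeg σ) (σσ≢0 ∘ sym))}}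
      (≤-from-difference (∑-nonNeg (λ i → square-nonNeg (N * y i - σ + σ * D i)))
        (sym expansion))
  where
  N = + n
  D = imbalance M
  σ = sum y
  Q = ∑[ i < n ] (y i * y i)
  P = ∑[ i < n ] (y i * D i)
  W : Fin n → ℤ
  W j = ∑[ i < n ] (y i * skew M i j)

  W≡y-σ : ∀ j → W j ≡ y j - σ
  W≡y-σ j = begin
    W j
      ≡⟨ sum-cong-≗ (λ i → trans (cong (y i *_) (skew-entry T i j))
                                 (spread (y i) (M i j) (identity i j))) ⟩
    ∑[ i < n ] (+ 2 * (y i * M i j) + -1ℤ * y i + 1ℤ * (y i * identity i j))
      ≡⟨ ∑-linear₃ (+ 2) -1ℤ 1ℤ (λ i → y i * M i j) y (λ i → y i * identity i j) ⟩
    + 2 * ∑[ i < n ] (y i * M i j) + -1ℤ * σ + 1ℤ * ∑[ i < n ] (y i * identity i j)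
      ≡⟨ cong₂ (λ u v → + 2 * u + -1ℤ * σ + 1ℤ * v) (null j) (∑-identity y j) ⟩
    + 2 * 0ℤ + -1ℤ * σ + 1ℤ * y j
      ≡⟨ collect σ (y j) ⟩
    y j - σ ∎
    where
    spread : ∀ y m e → y * (m + m - (1ℤ - e)) ≡ + 2 * (y * m) + -1ℤ * y + 1ℤ * (y * e)
    spread = solve-∀
    collect : ∀ s y → + 2 * 0ℤ + -1ℤ * s + 1ℤ * y ≡ y - s
    collect = solve-∀

  Q≡σσ : Q ≡ σ * σ
  Q≡σσ = ℤ.i-j≡0⇒i≡j Q (σ * σ) (begin
    Q - σ * σ                                      ≡⟨ weights Q σ ⟩
    1ℤ * Q + - σ * σ                               ≡⟨ ∑-linear 1ℤ (- σ) (λ j → y j * y j) y ⟨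
    ∑[ j < n ] (1ℤ * (y j * y j) + - σ * y j)      ≡⟨ sum-cong-≗ (λ j → factor σ (y j)) ⟩
    ∑[ j < n ] (y j * (y j - σ))                   ≡⟨ sum-cong-≗ (λ j → cong (y j *_) (sym (W≡y-σ j))) ⟩
    ∑[ j < n ] (y j * W j)                         ≡⟨ sum-cong-≗ (λ j → *-distribˡ-sum (y j) (λ i → y i * skew M i j)) ⟩
    ∑[ j < n ] ∑[ i < n ] (y j * (y i * skew M i j))
      ≡⟨ ∑∑-antisymmetric (λ j i → y j * (y i * skew M i j)) (λ j i →
           trans (cong (λ s → y j * (y i * s)) (skew-antisymmetric M i j)) (swap (y j) (y i) (skew M j i))) ⟩
    0ℤ                                             ∎)
    where
    weights : ∀ q s → q - s * s ≡ 1ℤ * q + - s * s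
    weights = solve-∀
    factor : ∀ s y → 1ℤ * (y * y) + - s * y ≡ y * (y - s)
    factor = solve-∀
    swap : ∀ a b s → a * (b * - s) ≡ - (b * (a * s))
    swap = solve-∀

  P≡σ-Nσ : P ≡ σ - N * σ
  P≡σ-Nσ = begin
    P                                         ≡⟨ sum-cong-≗ (λ i → *-distribˡ-sum (y i) (skew M i)) ⟩
    ∑[ i < n ] ∑[ j < n ] (y i * skew M i j)  ≡⟨ ∑-comm (λ i j → y i * skew M i j) ⟩
    sum W                                     ≡⟨ sum-cong-≗ (λ j → trans (W≡y-σ j) (weights (y j) σ)) ⟩
    ∑[ j < n ] (1ℤ * y j + - σ * 1ℤ)          ≡⟨ ∑-linear 1ℤ (- σ) y (λ _ → 1ℤ) ⟩
    1ℤ * σ + - σ * ∑[ j < n ] 1ℤ              ≡⟨ cong (λ k → 1ℤ * σ + - σ * k) (∑-one n) ⟩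
    1ℤ * σ + - σ * N                          ≡⟨ collect σ N ⟩
    σ - N * σ                                 ∎
    where
    weights : ∀ y s → y - s ≡ 1ℤ * y + - s * 1ℤ
    weights = solve-∀
    collect : ∀ s k → 1ℤ * s + - s * k ≡ s - k * s
    collect = solve-∀

  expansion : ∑[ i < n ] ((N * y i - σ + σ * D i) * (N * y i - σ + σ * D i))
    ≡ σ * σ * energy M - σ * σ * (N * (N - 1ℤ))
  expansion = begin
    ∑[ i < n ] ((N * y i - σ + σ * D i) * (N * y i - σ + σ * D i))
      ≡⟨ sum-cong-≗ (λ i → expand N σ (y i) (D i)) ⟩
    ∑[ i < n ] (1ℤ * quadratic i + 1ℤ * linear i)
      ≡⟨ ∑-linear 1ℤ 1ℤ quadratic linear ⟩
    1ℤ * sum quadratic + 1ℤ * sum linear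
      ≡⟨ cong₂ (λ u v → 1ℤ * u + 1ℤ * v)
           (∑-linear₃ (N * N) (σ * σ) (+ 2 * N * σ) (λ i → y i * y i) (λ i → D i * D i) (λ i → y i * D i))
           (∑-linear₃ (σ * σ) (- (+ 2 * N * σ)) (- (+ 2 * σ * σ)) (λ _ → 1ℤ) y D) ⟩
    1ℤ * (N * N * Q + σ * σ * energy M + + 2 * N * σ * P)
      + 1ℤ * (σ * σ * (∑[ i < n ] 1ℤ) + - (+ 2 * N * σ) * σ + - (+ 2 * σ * σ) * sum D)
      ≡⟨ cong₂ (λ u v → 1ℤ * u + 1ℤ * v)
           (cong₂ (λ q p → N * N * q + σ * σ * energy M + + 2 * N * σ * p) Q≡σσ P≡σ-Nσ)
           (cong₂ (λ k d → σ * σ * k + - (+ 2 * N * σ) * σ + - (+ 2 * σ * σ) * d) (∑-one n) (∑-imbalance M)) ⟩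
    1ℤ * (N * N * (σ * σ) + σ * σ * energy M + + 2 * N * σ * (σ - N * σ))
      + 1ℤ * (σ * σ * N + - (+ 2 * N * σ) * σ + - (+ 2 * σ * σ) * 0ℤ)
      ≡⟨ collect N σ (energy M) ⟩
    σ * σ * energy M - σ * σ * (N * (N - 1ℤ)) ∎
    where
    quadratic linear : Fin n → ℤ
    quadratic i = N * N * (y i * y i) + σ * σ * (D i * D i) + + 2 * N * σ * (y i * D i)
    linear i = σ * σ * 1ℤ + - (+ 2 * N * σ) * y i + - (+ 2 * σ * σ) * D i
    expand : ∀ N s y d → (N * y - s + s * d) * (N * y - s + s * d)
      ≡ 1ℤ * (N * N * (y * y) + s * s * (d * d) + + 2 * N * s * (y * d))
        + 1ℤ * (s * s * 1ℤ + - (+ 2 * N * s) * y + - (+ 2 * s * s) * d)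
    expand = solve-∀
    collect : ∀ N s E → 1ℤ * (N * N * (s * s) + s * s * E + + 2 * N * s * (s - N * s))
      + 1ℤ * (s * s * N + - (+ 2 * N * s) * s + - (+ 2 * s * s) * 0ℤ)
      ≡ s * s * E - s * s * (N * (N - 1ℤ))
    collect = solve-∀

  -- If σ were 0, then ∑ y² = σ² would force y = 0. So σ² is positive and can be cancelled from the
  -- bound.
  σσ≢0 : σ * σ ≢ 0ℤ
  σσ≢0 σσ≡0 = y≢0 (square≡0 (y i₀) (∑-nonNeg-zero (λ i → y i * y i)
    (λ i → square-nonNeg (y i)) (ℤ.≤-reflexive (trans Q≡σσ σσ≡0)) i₀))

-- Removing a vertex

data Arc (M : Matrix n) (i j : Fin n) : Set where
  forward  : M i j ≡ 1ℤ → M j i ≡ 0ℤ → Arc M i j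
  backward : M i j ≡ 0ℤ → M j i ≡ 1ℤ → Arc M i j

arc : {M : Matrix n} → IsTournament M → ∀ i j → i ≢ j → Arc M i j
arc {M = M} T i j i≢j = orient (M i j) (M j i) refl refl (zeroOne i j) (zeroOne j i)
  (trans (M+Mᵀ i j) (cong (λ x → 1ℤ - x) (identity-off i j i≢j)))
  where
  open IsTournament T
  orient : ∀ a b → M i j ≡ a → M j i ≡ b → a ≡ 0ℤ ⊎ a ≡ 1ℤ → b ≡ 0ℤ ⊎ b ≡ 1ℤ →
    a + b ≡ 1ℤ → Arc M i j
  orient _ _ p q (inj₁ refl) (inj₂ refl) _ = backward p q
  orient _ _ p q (inj₂ refl) (inj₁ refl) _ = forward p q
  orient _ _ _ _ (inj₁ refl) (inj₁ refl) ()
  orient _ _ _ _ (inj₂ refl) (inj₂ refl) ()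

diagonal≡0 : {M : Matrix n} → IsTournament M → ∀ i → M i i ≡ 0ℤ
diagonal≡0 {M = M} T i with IsTournament.zeroOne T i i
... | inj₁ Mᵢᵢ≡0 = Mᵢᵢ≡0
... | inj₂ Mᵢᵢ≡1 = contradiction (begin
  + 2             ≡⟨ cong₂ _+_ Mᵢᵢ≡1 Mᵢᵢ≡1 ⟨
  M i i + M i i   ≡⟨ IsTournament.M+Mᵀ T i i ⟩
  1ℤ - identity i i ≡⟨ cong (λ x → 1ℤ - x) (identity-diagonal i) ⟩
  0ℤ              ∎) λ ()

identity-punchIn : ∀ (v : Fin (suc n)) i j → identity (punchIn v i) (punchIn v j) ≡ identity i j
identity-punchIn v i j with i Fin.≟ j
... | yes refl = identity-diagonal (punchIn v i)
... | no  i≢j  = identity-off _ _ (i≢j ∘ Fin.punchIn-injective v i j)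

minor-isTournament : {M : Matrix (suc n)} → IsTournament M → ∀ v → IsTournament (minor M v v)
minor-isTournament T v = record
  { zeroOne = λ i j → zeroOne (punchIn v i) (punchIn v j)
  ; M+Mᵀ = λ i j → trans (M+Mᵀ (punchIn v i) (punchIn v j))
                         (cong (λ x → 1ℤ - x) (identity-punchIn v i j))
  }
  where open IsTournament T

skew-diagonal : ∀ (M : Matrix n) i → skew M i i ≡ 0ℤ
skew-diagonal M i = ℤ.+-inverseʳ (M i i)

skew-square : {M : Matrix n} → IsTournament M → ∀ i j → i ≢ j → skew M i j * skew M i j ≡ 1ℤ
skew-square T i j i≢j with arc T i j i≢j
... | forward  Mᵢⱼ≡1 Mⱼᵢ≡0 rewrite Mᵢⱼ≡1 | Mⱼᵢ≡0 = refl
... | backward Mᵢⱼ≡0 Mⱼᵢ≡1 rewrite Mᵢⱼ≡0 | Mⱼᵢ≡1 = refl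

𝟙 : {P : Set} → Dec P → ℤ
𝟙 P? = if does P? then 1ℤ else 0ℤ

𝟙-false : {P : Set} (P? : Dec P) → ¬ P → 𝟙 P? ≡ 0ℤ
𝟙-false P? ¬p = cong (if_then 1ℤ else 0ℤ) (dec-false P? ¬p)

-- The equation is asked for only under `P`: in the application `P` is j < k, which supplies the j ≠
-- k that the cycle identity requires.
𝟙-× : {P Q : Set} (P? : Dec P) (Q? : Dec Q) (c w : ℤ) → (P → c * 𝟙 Q? ≡ w) →
  c * 𝟙 (P? ×-dec Q?) ≡ 𝟙 P? * w
𝟙-× (no _)  Q? c w _  = ℤ.*-zeroʳ c
𝟙-× (yes p) Q? c w eq = trans (eq p) (sym (ℤ.*-identityˡ w))

module AddedVertex (M : Matrix (suc n)) (v : Fin (suc n)) where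

  N : ℤ
  N = + n

  T : Matrix n
  T = minor M v v

  D r : Fin n → ℤ
  D = imbalance T
  r j = skew M v (punchIn v j)

  R rD : ℤ
  R  = sum r
  rD = ∑[ j < n ] (r j * D j)

  imbalance-v : imbalance M v ≡ R
  imbalance-v = begin
    imbalance M v   ≡⟨ sum-remove (skew M v) ⟩
    skew M v v + R  ≡⟨ cong (_+ R) (skew-diagonal M v) ⟩
    0ℤ + R          ≡⟨ ℤ.+-identityˡ R ⟩
    R               ∎

  imbalance-old : ∀ j → imbalance M (punchIn v j) ≡ D j - r j
  imbalance-old j = begin
    imbalance M (punchIn v j)       ≡⟨ sum-remove (skew M (punchIn v j)) ⟩
    skew M (punchIn v j) v + D j    ≡⟨ cong (_+ D j) (skew-antisymmetric M (punchIn v j) v) ⟩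
    - r j + D j                     ≡⟨ ℤ.+-comm (- r j) (D j) ⟩
    D j - r j                       ∎

  -- Adding the weights of (j , k) and (k , j) gives 0 if v beats both or neither. If v beats j and
  -- k beats v, it gives 4 + 4 `skew T j k`, which is 8 exactly when v, j, k form a 3-cycle. This is
  -- the origin of the 8.
  pairWeight : Fin n → Fin n → ℤ
  pairWeight j k = 1ℤ - r j * r k + + 2 * (r j * skew T j k)

  ∑pairWeight : ℤ
  ∑pairWeight = ∑[ j < n ] ∑[ k < n ] pairWeight j k

  ∑pairWeight≡ : ∑pairWeight ≡ N * N - R * R + + 2 * rD
  ∑pairWeight≡ = begin
    ∑pairWeight
      ≡⟨ sum-cong-≗ (λ j → trans (sum-cong-≗ (λ k → inner (r j) (r k) (skew T j k)))
                                 (∑-linear₃ 1ℤ (- r j) (+ 2 * r j) (λ _ → 1ℤ) r (skew T j))) ⟩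
    ∑[ j < n ] (1ℤ * (∑[ k < n ] 1ℤ) + - r j * R + + 2 * r j * D j)
      ≡⟨ sum-cong-≗ (λ j → trans (cong (λ x → 1ℤ * x + - r j * R + + 2 * r j * D j) (∑-one n))
                                 (outer N R (r j) (D j))) ⟩
    ∑[ j < n ] (N * 1ℤ + - R * r j + + 2 * (r j * D j))
      ≡⟨ ∑-linear₃ N (- R) (+ 2) (λ _ → 1ℤ) r (λ j → r j * D j) ⟩
    N * (∑[ j < n ] 1ℤ) + - R * R + + 2 * rD
      ≡⟨ cong (λ x → N * x + - R * R + + 2 * rD) (∑-one n) ⟩
    N * N + - R * R + + 2 * rD
      ≡⟨ cong (λ x → N * N + x + + 2 * rD) (sym (ℤ.neg-distribˡ-* R R)) ⟩
    N * N - R * R + + 2 * rD ∎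
    where
    inner : ∀ x y s → 1ℤ - x * y + + 2 * (x * s) ≡ 1ℤ * 1ℤ + - x * y + + 2 * x * s
    inner = solve-∀
    outer : ∀ N R x d → 1ℤ * N + - x * R + + 2 * x * d ≡ N * 1ℤ + - R * x + + 2 * (x * d)
    outer = solve-∀

  module _ (tournament : IsTournament M) where

    r-square : ∀ j → r j * r j ≡ 1ℤ
    r-square j = skew-square tournament v (punchIn v j) (Fin.punchInᵢ≢i v j ∘ sym)

    -- The new vertex contributes R². Each old imbalance becomes D - r, and r² = 1 produces the
    -- summand N.
    energy-decomposition : energy M ≡ R * R + energy T - + 2 * rD + N
    energy-decomposition = begin
      energy M
        ≡⟨ sum-remove (λ i → imbalance M i * imbalance M i) ⟩
      imbalance M v * imbalance M v
        + ∑[ j < n ] (imbalance M (punchIn v j) * imbalance M (punchIn v j))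
        ≡⟨ cong₂ _+_ (cong₂ _*_ imbalance-v imbalance-v) (sum-cong-≗ term) ⟩
      R * R + ∑[ j < n ] (1ℤ * (D j * D j) + - + 2 * (r j * D j) + 1ℤ * 1ℤ)
        ≡⟨ cong (_+_ (R * R)) (∑-linear₃ 1ℤ (- + 2) 1ℤ (λ j → D j * D j) (λ j → r j * D j) (λ _ → 1ℤ)) ⟩
      R * R + (1ℤ * energy T + - + 2 * rD + 1ℤ * ∑[ j < n ] 1ℤ)
        ≡⟨ cong (λ x → R * R + (1ℤ * energy T + - + 2 * rD + 1ℤ * x)) (∑-one n) ⟩
      R * R + (1ℤ * energy T + - + 2 * rD + 1ℤ * N)
        ≡⟨ collect (R * R) (energy T) rD N ⟩
      R * R + energy T - + 2 * rD + N ∎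
      where
      expand : ∀ d x → (d - x) * (d - x) ≡ 1ℤ * (d * d) + - + 2 * (x * d) + 1ℤ * (x * x)
      expand = solve-∀
      collect : ∀ q e p N → q + (1ℤ * e + - + 2 * p + 1ℤ * N) ≡ q + e - + 2 * p + N
      collect = solve-∀
      term : ∀ j → imbalance M (punchIn v j) * imbalance M (punchIn v j)
        ≡ 1ℤ * (D j * D j) + - + 2 * (r j * D j) + 1ℤ * 1ℤ
      term j = begin
        imbalance M (punchIn v j) * imbalance M (punchIn v j)
          ≡⟨ cong₂ _*_ (imbalance-old j) (imbalance-old j) ⟩
        (D j - r j) * (D j - r j)
          ≡⟨ expand (D j) (r j) ⟩
        1ℤ * (D j * D j) + - + 2 * (r j * D j) + 1ℤ * (r j * r j)
          ≡⟨ cong (λ x → 1ℤ * (D j * D j) + - + 2 * (r j * D j) + 1ℤ * x) (r-square j) ⟩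
        1ℤ * (D j * D j) + - + 2 * (r j * D j) + 1ℤ * 1ℤ ∎

    -- R² and the cross term `rD` cancel. The arcs at v therefore affect the energy gained only
    -- through the number of 3-cycles through v.
    energy+∑pairWeight : energy M + ∑pairWeight ≡ energy T + (N * N + N)
    energy+∑pairWeight = trans (cong₂ _+_ energy-decomposition ∑pairWeight≡)
                               (collect R (energy T) rD N)
      where
      collect : ∀ R e p N →
        R * R + e - + 2 * p + N + (N * N - R * R + + 2 * p) ≡ e + (N * N + N)
      collect = solve-∀

    pairWeight-diagonal : ∀ j → pairWeight j j ≡ 0ℤ
    pairWeight-diagonal j = cong₂ (λ x s → 1ℤ - x + + 2 * s) (r-square j)
      (trans (cong (r j *_) (skew-diagonal T j)) (ℤ.*-zeroʳ (r j)))

    pairWeight-cycle : ∀ j k → j ≢ k →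
      pairWeight j k + pairWeight k j
      ≡ + 8 * 𝟙 (directedCycle? M v (punchIn v j) (punchIn v k)
                 ⊎-dec directedCycle? M v (punchIn v k) (punchIn v j))
    pairWeight-cycle j k j≢k
      with arc tournament v (punchIn v j) (Fin.punchInᵢ≢i v j ∘ sym)
         | arc tournament v (punchIn v k) (Fin.punchInᵢ≢i v k ∘ sym)
         | arc tournament (punchIn v j) (punchIn v k) (j≢k ∘ Fin.punchIn-injective v j k)
    ... | forward  a a′ | forward  b b′ | forward  c c′ rewrite a | a′ | b | b′ | c | c′ = refl
    ... | forward  a a′ | forward  b b′ | backward c c′ rewrite a | a′ | b | b′ | c | c′ = refl
    ... | forward  a a′ | backward b b′ | forward  c c′ rewrite a | a′ | b | b′ | c | c′ = refl
    ... | forward  a a′ | backward b b′ | backward c c′ rewrite a | a′ | b | b′ | c | c′ = refl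
    ... | backward a a′ | forward  b b′ | forward  c c′ rewrite a | a′ | b | b′ | c | c′ = refl
    ... | backward a a′ | forward  b b′ | backward c c′ rewrite a | a′ | b | b′ | c | c′ = refl
    ... | backward a a′ | backward b b′ | forward  c c′ rewrite a | a′ | b | b′ | c | c′ = refl
    ... | backward a a′ | backward b b′ | backward c c′ rewrite a | a′ | b | b′ | c | c′ = refl

    -- Without 3-cycles through v the weights are antisymmetric, so their double sum vanishes with
    -- no count of unordered pairs.
    acyclic⇒energy : (∀ j k → ¬ DirectedCycle M v j k) → energy M ≡ energy T + (N * N + N)
    acyclic⇒energy acyclic = begin
      energy M                ≡⟨ ℤ.+-identityʳ (energy M) ⟨
      energy M + 0ℤ           ≡⟨ cong (_+_ (energy M)) (∑∑-antisymmetric pairWeight anti) ⟨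
      energy M + ∑pairWeight  ≡⟨ energy+∑pairWeight ⟩
      energy T + (N * N + N)  ∎
      where
      cancel : ∀ j k → pairWeight j k + pairWeight k j ≡ 0ℤ
      cancel j k with j Fin.≟ k
      ... | yes refl = cong₂ _+_ (pairWeight-diagonal j) (pairWeight-diagonal j)
      ... | no  j≢k  = trans (pairWeight-cycle j k j≢k)
        (cong (λ x → + 8 * x) (𝟙-false (directedCycle? M v (punchIn v j) (punchIn v k)
                 ⊎-dec directedCycle? M v (punchIn v k) (punchIn v j))
          [ acyclic (punchIn v j) (punchIn v k) , acyclic (punchIn v k) (punchIn v j) ]′))
      opposite : ∀ a b → a + b ≡ 0ℤ → a ≡ - b
      opposite a b a+b≡0 = ℤ.i-j≡0⇒i≡j a (- b) (trans (cong (_+_ a) (ℤ.neg-involutive b)) a+b≡0)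
      anti : ∀ j k → pairWeight j k ≡ - pairWeight k j
      anti j k = opposite (pairWeight j k) (pairWeight k j) (cancel j k)

-- Counting 3-cycles

∑-filter-tabulate : ∀ {A : Set} {P : A → Set} (P? : Decidable P) (f : Fin n → A) →
  + length (filter P? (tabulate f)) ≡ ∑[ i < n ] 𝟙 (P? (f i))
∑-filter-tabulate {zero}  P? f = refl
∑-filter-tabulate {suc n} P? f with does (P? (f zero))
... | true  = cong (_+_ 1ℤ) (∑-filter-tabulate P? (f ∘ suc))
... | false = trans (∑-filter-tabulate P? (f ∘ suc)) (sym (ℤ.+-identityˡ _))

length-filter-map : ∀ {A B : Set} {P : B → Set} (P? : Decidable P) (g : A → B) xs →
  length (filter P? (map g xs)) ≡ length (filter (P? ∘ g) xs)
length-filter-map P? g []       = refl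
length-filter-map P? g (x ∷ xs) with does (P? (g x))
... | true  = cong suc (length-filter-map P? g xs)
... | false = length-filter-map P? g xs

∑-filter-cartesianProduct : ∀ {A B : Set} {P : A × B → Set} (P? : Decidable P)
  (f : Fin n → A) ys →
  + length (filter P? (cartesianProduct (tabulate f) ys))
  ≡ ∑[ i < n ] (+ length (filter (λ y → P? (f i , y)) ys))
∑-filter-cartesianProduct {zero}  P? f ys = refl
∑-filter-cartesianProduct {suc n} P? f ys = begin
  + length (filter P? (row ++ rest))
    ≡⟨ cong (λ l → + length l) (filter-++ P? row rest) ⟩
  + length (filter P? row ++ filter P? rest)
    ≡⟨ cong +_ (length-++ (filter P? row)) ⟩
  + (length (filter P? row) ℕ.+ length (filter P? rest))
    ≡⟨ ℤ.pos-+ (length (filter P? row)) _ ⟩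
  + length (filter P? row) + + length (filter P? rest)
    ≡⟨ cong₂ _+_ (cong +_ (length-filter-map P? (f zero ,_) ys))
                 (∑-filter-cartesianProduct P? (f ∘ suc) ys) ⟩
  ∑[ i < suc n ] (+ length (filter (λ y → P? (f i , y)) ys)) ∎
  where
  row  = map (f zero ,_) ys
  rest = cartesianProduct (tabulate (f ∘ suc)) ys

C₃≡∑ : (M : Matrix n) →
  + C₃ M ≡ ∑[ i < n ] ∑[ j < n ] ∑[ k < n ] 𝟙 (cyclic3Subset? M (i , j , k))
C₃≡∑ {n} M = trans (∑-filter-cartesianProduct (cyclic3Subset? M) (λ i → i) _)
  (sum-cong-≗ λ i → trans (∑-filter-cartesianProduct (λ jk → cyclic3Subset? M (i , jk)) (λ j → j) (allFin n))
    (sum-cong-≗ λ j → ∑-filter-tabulate (λ k → cyclic3Subset? M (i , j , k)) (λ k → k)))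

-- Bridges the increasing enumerations counted by `C₃` and the ordered pairs over which
-- `∑pairWeight` runs.
∑-pairs : (h : Fin n → Fin n → ℤ) →
  ∑[ j < n ] ∑[ k < n ] (𝟙 (j Fin.<? k) * (h j k + h k j)) + ∑[ j < n ] h j j
  ≡ ∑[ j < n ] ∑[ k < n ] h j k
∑-pairs {zero}  h = refl
∑-pairs {suc n} h = begin
  0ℤ * (h₀₀ + h₀₀) + ∑[ k < n ] (1ℤ * (h zero (suc k) + h (suc k) zero))
    + ∑[ j < n ] (0ℤ * (h (suc j) zero + h zero (suc j)) + inner j) + (h₀₀ + diag)
    ≡⟨ cong₂ (λ x y → 0ℤ * (h₀₀ + h₀₀) + x + y + (h₀₀ + diag))
         (trans (sum-cong-≗ λ k → ℤ.*-identityˡ (h zero (suc k) + h (suc k) zero))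
                (∑-distrib-+ (λ k → h zero (suc k)) (λ k → h (suc k) zero)))
         (sum-cong-≗ λ j → drop (h (suc j) zero + h zero (suc j)) (inner j)) ⟩
  0ℤ * (h₀₀ + h₀₀) + (row + column) + sum inner + (h₀₀ + diag)
    ≡⟨ rearrange h₀₀ row column (sum inner) diag ⟩
  h₀₀ + row + (column + (sum inner + diag))
    ≡⟨ cong (λ x → h₀₀ + row + (column + x)) (∑-pairs (λ j k → h (suc j) (suc k))) ⟩
  h₀₀ + row + (column + ∑[ j < n ] ∑[ k < n ] h (suc j) (suc k))
    ≡⟨ cong (_+_ (h₀₀ + row)) (∑-distrib-+ (λ j → h (suc j) zero) (λ j → ∑[ k < n ] h (suc j) (suc k))) ⟨
  h₀₀ + row + ∑[ j < n ] (h (suc j) zero + ∑[ k < n ] h (suc j) (suc k)) ∎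
  where
  h₀₀    = h zero zero
  row    = ∑[ k < n ] h zero (suc k)
  column = ∑[ j < n ] h (suc j) zero
  diag   = ∑[ j < n ] h (suc j) (suc j)
  inner : Fin n → ℤ
  inner j = ∑[ k < n ] (𝟙 (j Fin.<? k) * (h (suc j) (suc k) + h (suc k) (suc j)))
  drop : ∀ x y → 0ℤ * x + y ≡ y
  drop = solve-∀
  rearrange : ∀ a r c i d → 0ℤ * (a + a) + (r + c) + i + (a + d) ≡ a + r + (c + (i + d))
  rearrange = solve-∀

-- Vertex 0 is the least, so it can occur in an increasing triple only in first position. The
-- triples split into those through 0 and those of the minor.
C₃-suc : {M : Matrix (suc n)} → IsTournament M →
  + 8 * + C₃ M ≡ AddedVertex.∑pairWeight M zero + + 8 * + C₃ (minor M zero zero)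
C₃-suc {n} {M} tournament = begin
  + 8 * + C₃ M
    ≡⟨ cong (λ x → + 8 * x) (C₃≡∑ M) ⟩
  + 8 * (X zero + ∑[ i < n ] X (suc i))
    ≡⟨ cong (λ x → + 8 * x) (cong₂ _+_ X-zero (sum-cong-≗ X-suc)) ⟩
  + 8 * (through + ∑[ i < n ] ∑[ j < n ] ∑[ k < n ] 𝟙 (cyclic3Subset? T (i , j , k)))
    ≡⟨ cong (λ x → + 8 * (through + x)) (C₃≡∑ T) ⟨
  + 8 * (through + + C₃ T)
    ≡⟨ ℤ.*-distribˡ-+ (+ 8) through (+ C₃ T) ⟩
  + 8 * through + + 8 * + C₃ T
    ≡⟨ cong (_+ + 8 * + C₃ T) through≡ ⟩
  ∑pairWeight + + 8 * + C₃ T ∎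
  where
  open AddedVertex M zero hiding (N)
  X : Fin (suc n) → ℤ
  X i = ∑[ j < suc n ] ∑[ k < suc n ] 𝟙 (cyclic3Subset? M (i , j , k))
  cycleAt0 : ∀ j k → Dec (DirectedCycle M zero (suc j) (suc k) ⊎ DirectedCycle M zero (suc k) (suc j))
  cycleAt0 j k = directedCycle? M zero (suc j) (suc k) ⊎-dec directedCycle? M zero (suc k) (suc j)
  through = ∑[ j < n ] ∑[ k < n ] 𝟙 ((j Fin.<? k) ×-dec cycleAt0 j k)

  X-zero : X zero ≡ through
  X-zero = trans (cong₂ _+_ (∑-zero {suc n} (λ _ → 0ℤ) (λ _ → refl))
                            (sum-cong-≗ λ j → ℤ.+-identityˡ (∑[ k < n ] 𝟙 ((j Fin.<? k) ×-dec cycleAt0 j k))))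
                 (ℤ.+-identityˡ through)

  X-suc : ∀ i → X (suc i) ≡ ∑[ j < n ] ∑[ k < n ] 𝟙 (cyclic3Subset? T (i , j , k))
  X-suc i = trans (cong₂ _+_ (∑-zero {suc n} (λ _ → 0ℤ) (λ _ → refl))
                    (sum-cong-≗ λ j → trans (cong (_+ ∑[ k < n ] 𝟙 (cyclic3Subset? T (i , j , k)))
                                                  (𝟙-false (cyclic3Subset? M (suc i , suc j , zero)) λ { (_ , () , _) }))
                                            (ℤ.+-identityˡ (∑[ k < n ] 𝟙 (cyclic3Subset? T (i , j , k))))))
                  (ℤ.+-identityˡ (∑[ j < n ] ∑[ k < n ] 𝟙 (cyclic3Subset? T (i , j , k))))

  term : ∀ j k → + 8 * 𝟙 ((j Fin.<? k) ×-dec cycleAt0 j k)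
    ≡ 𝟙 (j Fin.<? k) * (pairWeight j k + pairWeight k j)
  term j k = 𝟙-× (j Fin.<? k) (cycleAt0 j k) (+ 8) (pairWeight j k + pairWeight k j) λ j<k →
    sym (pairWeight-cycle tournament j k λ { refl → ℕ.<-irrefl refl j<k })

  through≡ : + 8 * through ≡ ∑pairWeight
  through≡ = begin
    + 8 * through
      ≡⟨ *-distribˡ-sum (+ 8) (λ j → ∑[ k < n ] 𝟙 ((j Fin.<? k) ×-dec cycleAt0 j k)) ⟩
    ∑[ j < n ] (+ 8 * ∑[ k < n ] 𝟙 ((j Fin.<? k) ×-dec cycleAt0 j k))
      ≡⟨ sum-cong-≗ (λ j → trans (*-distribˡ-sum (+ 8) (λ k → 𝟙 ((j Fin.<? k) ×-dec cycleAt0 j k)))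
                                 (sum-cong-≗ (term j))) ⟩
    ∑[ j < n ] ∑[ k < n ] (𝟙 (j Fin.<? k) * (pairWeight j k + pairWeight k j))
      ≡⟨ ℤ.+-identityʳ _ ⟨
    ∑[ j < n ] ∑[ k < n ] (𝟙 (j Fin.<? k) * (pairWeight j k + pairWeight k j)) + 0ℤ
      ≡⟨ cong (_+_ (∑[ j < n ] ∑[ k < n ] (𝟙 (j Fin.<? k) * (pairWeight j k + pairWeight k j))))
              (∑-zero (λ j → pairWeight j j) (pairWeight-diagonal tournament)) ⟨
    ∑[ j < n ] ∑[ k < n ] (𝟙 (j Fin.<? k) * (pairWeight j k + pairWeight k j)) + ∑[ j < n ] pairWeight j j
      ≡⟨ ∑-pairs pairWeight ⟩
    ∑pairWeight ∎

-- In closed form (n - 1)n(n + 1)/3, the energy of a transitive tournament; the recursion matches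
-- the removal of one vertex.
energyBudget : ℕ → ℤ
energyBudget zero    = 0ℤ
energyBudget (suc n) = energyBudget n + (+ n * + n + + n)

C₃-energy : {M : Matrix n} → IsTournament M → + 8 * + C₃ M + energy M ≡ energyBudget n
C₃-energy {zero}      tournament = refl
C₃-energy {suc n} {M} tournament = begin
  + 8 * + C₃ M + energy M
    ≡⟨ cong (_+ energy M) (C₃-suc tournament) ⟩
  ∑pairWeight + + 8 * + C₃ T + energy M
    ≡⟨ rearrange ∑pairWeight (+ 8 * + C₃ T) (energy M) ⟩
  + 8 * + C₃ T + (energy M + ∑pairWeight)
    ≡⟨ cong (_+_ (+ 8 * + C₃ T)) (energy+∑pairWeight tournament) ⟩
  + 8 * + C₃ T + (energy T + (N * N + N))
    ≡⟨ ℤ.+-assoc (+ 8 * + C₃ T) (energy T) (N * N + N) ⟨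
  + 8 * + C₃ T + energy T + (N * N + N)
    ≡⟨ cong (_+ (N * N + N)) (C₃-energy (minor-isTournament tournament zero)) ⟩
  energyBudget (suc n) ∎
  where
  open AddedVertex M zero
  rearrange : ∀ p c e → p + c + e ≡ c + (e + p)
  rearrange = solve-∀

C₃-antitone : {M M′ : Matrix n} → IsTournament M → IsTournament M′ →
  C₃ M′ ℕ.≤ C₃ M → energy M ≤ energy M′
C₃-antitone {n} {M} {M′} t t′ C₃≤ = ≤-from-difference
  (ℤ.i≤j⇒0≤j-i (ℤ.*-monoˡ-≤-nonNeg (+ 8) (+≤+ C₃≤)))
  (difference (+ 8 * + C₃ M) (energy M) (+ 8 * + C₃ M′) (energy M′)
    (trans (C₃-energy t) (sym (C₃-energy t′))))
  where
  difference : ∀ c e c′ e′ → c + e ≡ c′ + e′ → e′ - e ≡ c - c′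
  difference c e c′ e′ eq = begin
    e′ - e              ≡⟨ expose c′ e e′ ⟩
    c′ + e′ - c′ - e    ≡⟨ cong (λ x → x - c′ - e) eq ⟨
    c + e - c′ - e      ≡⟨ cancel c e c′ ⟩
    c - c′              ∎
    where
    expose : ∀ c′ e e′ → e′ - e ≡ c′ + e′ - c′ - e
    expose = solve-∀
    cancel : ∀ c e c′ → c + e - c′ - e ≡ c - c′
    cancel = solve-∀

-- A singular tournament of small energy

addVertex : (Fin n → ℤ) → Matrix n → Matrix (suc n)
addVertex x T zero    zero    = 0ℤ
addVertex x T zero    (suc j) = x j
addVertex x T (suc i) zero    = 1ℤ - x i
addVertex x T (suc i) (suc j) = T i j

addVertex-isTournament : {x : Fin n → ℤ} {T : Matrix n} → (∀ j → x j ≡ 0ℤ ⊎ x j ≡ 1ℤ) →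
  IsTournament T → IsTournament (addVertex x T)
addVertex-isTournament {x = x} {T} x01 t = record { zeroOne = entries ; M+Mᵀ = sums }
  where
  open IsTournament t
  entries : ∀ i j → addVertex x T i j ≡ 0ℤ ⊎ addVertex x T i j ≡ 1ℤ
  entries zero    zero    = inj₁ refl
  entries zero    (suc j) = x01 j
  entries (suc i) zero with x01 i
  ... | inj₁ x≡0 = inj₂ (cong (λ y → 1ℤ - y) x≡0)
  ... | inj₂ x≡1 = inj₁ (cong (λ y → 1ℤ - y) x≡1)
  entries (suc i) (suc j) = zeroOne i j
  complement : ∀ y → y + (1ℤ - y) ≡ 1ℤ
  complement = solve-∀
  sums : ∀ i j → addVertex x T i j + addVertex x T j i ≡ allOnes i j - identity i j
  sums zero    zero    = refl
  sums zero    (suc j) = complement (x j)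
  sums (suc i) zero    = trans (ℤ.+-comm (1ℤ - x i) (x i)) (complement (x i))
  sums (suc i) (suc j) = trans (M+Mᵀ i j) (cong (λ e → 1ℤ - e) (sym (identity-punchIn zero i j)))

-- Integer-valued because it serves twice: as an entry of `alternating`, and as the least square
-- that parity allows for an imbalance in order n.
evenIndicator : ℕ → ℤ
evenIndicator zero    = 1ℤ
evenIndicator (suc n) = 1ℤ - evenIndicator n

evenIndicator-01 : ∀ n → evenIndicator n ≡ 0ℤ ⊎ evenIndicator n ≡ 1ℤ
evenIndicator-01 zero = inj₂ refl
evenIndicator-01 (suc n) with evenIndicator-01 n
... | inj₁ e = inj₂ (cong (λ x → 1ℤ - x) e)
... | inj₂ e = inj₁ (cong (λ x → 1ℤ - x) e)

sign± : ℕ → ℤ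
sign± n = evenIndicator n - (1ℤ - evenIndicator n)

-- For i < j, vertex i beats vertex j exactly when j - i is odd.
alternating : ∀ n → Matrix n
alternating zero    ()
alternating (suc n) = addVertex (evenIndicator ∘ toℕ) (alternating n)

alternating-isTournament : ∀ n → IsTournament (alternating n)
alternating-isTournament zero    = record { zeroOne = λ () ; M+Mᵀ = λ () }
alternating-isTournament (suc n) =
  addVertex-isTournament (evenIndicator-01 ∘ toℕ) (alternating-isTournament n)

∑-sign± : ∀ n → ∑[ j < n ] sign± (toℕ j) ≡ 1ℤ - evenIndicator n
∑-sign± zero    = refl
∑-sign± (suc n) = begin
  1ℤ + ∑[ j < n ] sign± (suc (toℕ j))   ≡⟨ cong (_+_ 1ℤ) (sum-cong-≗ {n} λ j → flip (evenIndicator (toℕ j))) ⟩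
  1ℤ + ∑[ j < n ] (- sign± (toℕ j))     ≡⟨ cong (_+_ 1ℤ) (∑-neg {n} (sign± ∘ toℕ)) ⟩
  1ℤ - ∑[ j < n ] sign± (toℕ j)         ≡⟨ cong (λ x → 1ℤ - x) (∑-sign± n) ⟩
  1ℤ - (1ℤ - evenIndicator n)           ∎
  where
  flip : ∀ e → 1ℤ - e - (1ℤ - (1ℤ - e)) ≡ - (e - (1ℤ - e))
  flip = solve-∀

imbalance-alternating : ∀ n j → imbalance (alternating n) j ≡ evenIndicator n * sign± (toℕ j)
imbalance-alternating (suc n) zero = begin
  imbalance (alternating (suc n)) zero  ≡⟨ AddedVertex.imbalance-v (alternating (suc n)) zero ⟩
  ∑[ j < n ] sign± (toℕ j)              ≡⟨ ∑-sign± n ⟩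
  1ℤ - evenIndicator n                  ≡⟨ ℤ.*-identityʳ (1ℤ - evenIndicator n) ⟨
  (1ℤ - evenIndicator n) * 1ℤ           ∎
imbalance-alternating (suc n) (suc j) = begin
  imbalance (alternating (suc n)) (suc j)               ≡⟨ AddedVertex.imbalance-old (alternating (suc n)) zero j ⟩
  imbalance (alternating n) j - sign± (toℕ j)           ≡⟨ cong (_- sign± (toℕ j)) (imbalance-alternating n j) ⟩
  evenIndicator n * sign± (toℕ j) - sign± (toℕ j)       ≡⟨ factor (evenIndicator n) (evenIndicator (toℕ j)) ⟩
  evenIndicator (suc n) * sign± (suc (toℕ j))           ∎
  where
  factor : ∀ e s → e * (s - (1ℤ - s)) - (s - (1ℤ - s)) ≡ (1ℤ - e) * (1ℤ - s - (1ℤ - (1ℤ - s)))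
  factor = solve-∀

-- The minimum over all tournaments of order n: every imbalance is 0 in odd order and ±1 in even
-- order.
energy-alternating : ∀ n → energy (alternating n) ≡ evenIndicator n * + n
energy-alternating n = begin
  energy (alternating n)              ≡⟨ sum-cong-≗ term ⟩
  ∑[ j < n ] (evenIndicator n * 1ℤ)   ≡⟨ *-distribˡ-sum {n} (evenIndicator n) (λ _ → 1ℤ) ⟨
  evenIndicator n * ∑[ j < n ] 1ℤ     ≡⟨ cong (evenIndicator n *_) (∑-one n) ⟩
  evenIndicator n * + n               ∎
  where
  squares : ∀ e s → e ≡ 0ℤ ⊎ e ≡ 1ℤ → s ≡ 0ℤ ⊎ s ≡ 1ℤ →
    e * (s - (1ℤ - s)) * (e * (s - (1ℤ - s))) ≡ e * 1ℤ
  squares _ _ (inj₁ refl) (inj₁ refl) = refl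
  squares _ _ (inj₁ refl) (inj₂ refl) = refl
  squares _ _ (inj₂ refl) (inj₁ refl) = refl
  squares _ _ (inj₂ refl) (inj₂ refl) = refl
  term : ∀ j → imbalance (alternating n) j * imbalance (alternating n) j ≡ evenIndicator n * 1ℤ
  term j = trans (cong₂ _*_ (imbalance-alternating n j) (imbalance-alternating n j))
    (squares (evenIndicator n) (evenIndicator (toℕ j)) (evenIndicator-01 n) (evenIndicator-01 (toℕ j)))

-- The competitor for a maximizer. The zero row makes vertex 0 a sink, hence on no 3-cycle, and
-- makes the determinant vanish at once.
extremal : ∀ n → Matrix (suc n)
extremal n = addVertex (λ _ → 0ℤ) (alternating n)

extremal-∈𝒮 : ∀ n → extremal n ∈𝒮
extremal-∈𝒮 n = addVertex-isTournament (λ _ → inj₁ refl) (alternating-isTournament n) ,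
  det-cleared (extremal n) (λ _ → refl)

extremal-acyclic : ∀ j k → ¬ DirectedCycle (extremal n) zero j k
extremal-acyclic zero    k (() , _)
extremal-acyclic (suc j) k (() , _)

-- Regularity

module _ {M : Matrix n} (tournament : IsTournament M) where
  open IsTournament tournament

  outSum inSum : Fin n → ℤ
  outSum i = ∑[ j < n ] M i j
  inSum i  = ∑[ j < n ] M j i

  outSum≡outdegree : ∀ i → outSum i ≡ + outdegree M i
  outSum≡outdegree i = sym (trans (∑-filter-tabulate (beats? M i) (λ j → j)) (sum-cong-≗ term))
    where
    term : ∀ j → 𝟙 (beats? M i j) ≡ M i j
    term j with zeroOne i j
    ... | inj₁ e rewrite e = refl
    ... | inj₂ e rewrite e = refl

  imbalance-inSum : ∀ i → imbalance M i ≡ + n - 1ℤ - + 2 * inSum i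
  imbalance-inSum i = begin
    imbalance M i
      ≡⟨ sum-cong-≗ (λ j → trans (skew-antisymmetric M i j)
           (trans (cong -_ (skew-entry tournament j i)) (spread (M j i) (identity j i)))) ⟩
    ∑[ j < n ] (- + 2 * M j i + 1ℤ * 1ℤ + -1ℤ * (1ℤ * identity j i))
      ≡⟨ ∑-linear₃ (- + 2) 1ℤ -1ℤ (λ j → M j i) (λ _ → 1ℤ) (λ j → 1ℤ * identity j i) ⟩
    - + 2 * inSum i + 1ℤ * (∑[ j < n ] 1ℤ) + -1ℤ * ∑[ j < n ] (1ℤ * identity j i)
      ≡⟨ cong₂ (λ x y → - + 2 * inSum i + 1ℤ * x + -1ℤ * y) (∑-one n) (∑-identity (λ _ → 1ℤ) i) ⟩
    - + 2 * inSum i + 1ℤ * + n + -1ℤ * 1ℤ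
      ≡⟨ collect (inSum i) (+ n) ⟩
    + n - 1ℤ - + 2 * inSum i ∎
    where
    spread : ∀ a e → - (a + a - (1ℤ - e)) ≡ - + 2 * a + 1ℤ * 1ℤ + -1ℤ * (1ℤ * e)
    spread = solve-∀
    collect : ∀ s N → - + 2 * s + 1ℤ * N + -1ℤ * 1ℤ ≡ N - 1ℤ - + 2 * s
    collect = solve-∀

  imbalance-outSum : ∀ i → imbalance M i ≡ + 2 * outSum i - (+ n - 1ℤ)
  imbalance-outSum i = begin
    imbalance M i                                              ≡⟨ out-in ⟩
    outSum i - inSum i                                         ≡⟨ double (outSum i) (inSum i) ⟩
    + 2 * outSum i - (outSum i - inSum i + + 2 * inSum i)      ≡⟨ cong (λ x → + 2 * outSum i - (x + + 2 * inSum i))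
                                                                    (trans (sym out-in) (imbalance-inSum i)) ⟩
    + 2 * outSum i - (+ n - 1ℤ - + 2 * inSum i + + 2 * inSum i)  ≡⟨ cancel (outSum i) (+ n - 1ℤ) (inSum i) ⟩
    + 2 * outSum i - (+ n - 1ℤ)                                ∎
    where
    weights : ∀ a b → a - b ≡ 1ℤ * a + -1ℤ * b
    weights = solve-∀
    out-in : imbalance M i ≡ outSum i - inSum i
    out-in = trans (sum-cong-≗ (λ j → weights (M i j) (M j i)))
      (trans (∑-linear 1ℤ -1ℤ (M i) (λ j → M j i)) (sym (weights (outSum i) (inSum i))))
    double : ∀ a b → a - b ≡ + 2 * a - (a - b + + 2 * b)
    double = solve-∀
    cancel : ∀ a N s → + 2 * a - (N - + 2 * s + + 2 * s) ≡ + 2 * a - N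
    cancel = solve-∀

  imbalance-outdegree : ∀ i → imbalance M i ≡ + 2 * + outdegree M i - (+ n - 1ℤ)
  imbalance-outdegree i =
    trans (imbalance-outSum i) (cong (λ x → + 2 * x - (+ n - 1ℤ)) (outSum≡outdegree i))

  entry-nonNeg : ∀ i j → 0ℤ ≤ M i j
  entry-nonNeg i j with zeroOne i j
  ... | inj₁ e = ℤ.≤-reflexive (sym e)
  ... | inj₂ e = subst (0ℤ ≤_) (sym e) (+≤+ ℕ.z≤n)

  inSum≡0⇒source : ∀ v → inSum v ≡ 0ℤ → Source M v
  inSum≡0⇒source v in≡0 u u≢v with arc tournament u v u≢v
  ... | backward _ Mᵥᵤ≡1 = Mᵥᵤ≡1
  ... | forward Mᵤᵥ≡1 _ = contradiction
    (trans (sym (∑-nonNeg-zero (λ j → M j v) (λ j → entry-nonNeg j v) (ℤ.≤-reflexive in≡0) u)) Mᵤᵥ≡1) λ ()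

  outSum≡0⇒sink : ∀ v → outSum v ≡ 0ℤ → Sink M v
  outSum≡0⇒sink v out≡0 u u≢v with arc tournament u v u≢v
  ... | forward Mᵤᵥ≡1 _ = Mᵤᵥ≡1
  ... | backward _ Mᵥᵤ≡1 = contradiction
    (trans (sym (∑-nonNeg-zero (M v) (entry-nonNeg v) (ℤ.≤-reflexive out≡0) u)) Mᵥᵤ≡1) λ ()

Balanced : Matrix n → Set
Balanced T = ∀ i → -1ℤ ≤ imbalance T i × imbalance T i ≤ 1ℤ

square≤1⇒bounds : ∀ a → a * a ≤ 1ℤ → -1ℤ ≤ a × a ≤ 1ℤ
square≤1⇒bounds (+ 0)           _                = -≤+ , +≤+ ℕ.z≤n
square≤1⇒bounds (+ 1)           _                = -≤+ , ℤ.≤-refl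
square≤1⇒bounds (+ suc (suc a)) (+≤+ (ℕ.s≤s ()))
square≤1⇒bounds -[1+ 0 ]        _                = ℤ.≤-refl , -≤+
square≤1⇒bounds -[1+ suc a ]    (+≤+ (ℕ.s≤s ()))

≢0⇒1≤square : ∀ a → a ≢ 0ℤ → 1ℤ ≤ a * a
≢0⇒1≤square (+ 0)     a≢0 = contradiction refl a≢0
≢0⇒1≤square (+ suc a) _   = +≤+ (ℕ.s≤s ℕ.z≤n)
≢0⇒1≤square -[1+ a ]  _   = +≤+ (ℕ.s≤s ℕ.z≤n)

∣m-n∣≤1 : ∀ {m n} → m ℕ.≤ n ℕ.+ 1 → n ℕ.≤ m ℕ.+ 1 → ℕ.∣ m - n ∣ ℕ.≤ 1
∣m-n∣≤1 {m} {n} m≤n+1 n≤m+1 with ℕ.≤-total m n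
... | inj₁ m≤n = subst (ℕ._≤ 1) (sym (ℕ.m≤n⇒∣m-n∣≡n∸m m≤n)) (ℕ.m≤n+o⇒m∸n≤o n m n≤m+1)
... | inj₂ n≤m = subst (ℕ._≤ 1) (sym (ℕ.m≤n⇒∣n-m∣≡n∸m n≤m)) (ℕ.m≤n+o⇒m∸n≤o m n m≤n+1)

*-nonNeg : ∀ {a b} → 0ℤ ≤ a → 0ℤ ≤ b → 0ℤ ≤ a * b
*-nonNeg {a} {b} 0≤a 0≤b =
  subst (_≤ a * b) (ℤ.*-zeroʳ a) (ℤ.*-monoˡ-≤-nonNeg a {{nonNegative 0≤a}} 0≤b)

bounds⇒square≤ : ∀ b {a} → - b ≤ a → a ≤ b → a * a ≤ b * b
bounds⇒square≤ b {a} -b≤a a≤b = ≤-from-difference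
  (*-nonNeg (ℤ.i≤j⇒0≤j-i a≤b) (ℤ.i≤j⇒0≤j-i -b≤a)) (factor a b)
  where
  factor : ∀ a b → b * b - a * a ≡ (b - a) * (a - - b)
  factor = solve-∀

balanced⇒outdegree≤ : {T : Matrix n} → IsTournament T → Balanced T →
  ∀ i j → outdegree T i ℕ.≤ outdegree T j ℕ.+ 1
balanced⇒outdegree≤ {n} {T} t balanced i j =
  ℤ.drop‿+≤+ (ℤ.*-cancelˡ-≤-pos (+ outdegree T i) (+ outdegree T j + 1ℤ) (+ 2)
    (≤-from-difference
      (ℤ.+-mono-≤ (ℤ.i≤j⇒0≤j-i (subst (_≤ 1ℤ) (imbalance-outdegree t i) (proj₂ (balanced i))))
                  (ℤ.i≤j⇒0≤j-i (subst (-1ℤ ≤_) (imbalance-outdegree t j) (proj₁ (balanced j)))))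
      (rearrange (+ outdegree T i) (+ outdegree T j) (+ n - 1ℤ))))
  where
  rearrange : ∀ a b N → + 2 * (b + 1ℤ) - + 2 * a ≡ 1ℤ - (+ 2 * a - N) + (+ 2 * b - N - -1ℤ)
  rearrange = solve-∀

-- `AlmostRegular` requires the difference 1 to be attained. A finite search decides this, and if it
-- fails all differences are 0.
balanced⇒regular⊎almostRegular : {T : Matrix n} → IsTournament T → Balanced T →
  Regular T ⊎ AlmostRegular T
balanced⇒regular⊎almostRegular {T = T} t balanced
  with Fin.any? (λ i → Fin.any? (λ j → ℕ.∣ outdegree T i - outdegree T j ∣ ℕ.≟ 1))
... | yes (i , j , ≡1) = inj₂ (t , (i , j , ≡1) , λ i j →
        ∣m-n∣≤1 (balanced⇒outdegree≤ t balanced i j) (balanced⇒outdegree≤ t balanced j i))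
... | no ≢1 = inj₁ (t , λ i j → ℕ.∣m-n∣≡0⇒m≡n (ℕ.n<1⇒n≡0 (ℕ.≤∧≢⇒<
        (∣m-n∣≤1 (balanced⇒outdegree≤ t balanced i j) (balanced⇒outdegree≤ t balanced j i))
        λ e → ≢1 (i , j , e))))

-- A value of at least 2 would make all values nonnegative; as they sum to 0, all of them would be
-- 0, that value included.
zeroSum-spread2⇒≤1 : (f : Fin n → ℤ) → sum f ≡ 0ℤ → (∀ i j → f i ≤ f j + + 2) →
  ∀ i → f i ≤ 1ℤ
zeroSum-spread2⇒≤1 f ∑f≡0 spread i with f i ℤ.≤? 1ℤ
... | yes fᵢ≤1 = fᵢ≤1
... | no  fᵢ≰1 = contradiction
  (subst (_≤ 1ℤ) (sym (∑-nonNeg-zero f 0≤f (ℤ.≤-reflexive ∑f≡0) i)) (+≤+ ℕ.z≤n)) fᵢ≰1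
  where
  rearrange : ∀ a b → b - 0ℤ ≡ b + + 2 - a + (a - + 2)
  rearrange = solve-∀
  0≤f : ∀ j → 0ℤ ≤ f j
  0≤f j = ≤-from-difference
    (ℤ.+-mono-≤ (ℤ.i≤j⇒0≤j-i (spread i j)) (ℤ.i≤j⇒0≤j-i (ℤ.i<j⇒suc[i]≤j (ℤ.≰⇒> fᵢ≰1))))
    (rearrange (f i) (f j))

closeOutdegrees⇒balanced : {T : Matrix n} → IsTournament T →
  (∀ i j → ℕ.∣ outdegree T i - outdegree T j ∣ ℕ.≤ 1) → Balanced T
closeOutdegrees⇒balanced {n} {T} t close i =
  ℤ.neg-cancel-≤ (zeroSum-spread2⇒≤1 (λ i → - imbalance T i)
    (trans (∑-neg (imbalance T)) (cong -_ (∑-imbalance T)))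
    (λ i j → ≤-from-difference (ℤ.i≤j⇒0≤j-i (spread j i)) (flip (imbalance T i) (imbalance T j))) i) ,
  zeroSum-spread2⇒≤1 (imbalance T) (∑-imbalance T) spread i
  where
  flip : ∀ a b → - b + + 2 - - a ≡ a + + 2 - b
  flip = solve-∀
  outdegree≤ : ∀ i j → outdegree T i ℕ.≤ outdegree T j ℕ.+ 1
  outdegree≤ i j = ℕ.≤-trans (ℕ.m≤n+∣m-n∣ (outdegree T i) (outdegree T j))
                             (ℕ.+-monoʳ-≤ (outdegree T j) (close i j))
  rearrange : ∀ a b N → + 2 * b - N + + 2 - (+ 2 * a - N) ≡ + 2 * (b + 1ℤ - a)
  rearrange = solve-∀
  spread : ∀ i j → imbalance T i ≤ imbalance T j + + 2
  spread i j rewrite imbalance-outdegree t i | imbalance-outdegree t j = ≤-from-difference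
    (*-nonNeg {+ 2} (+≤+ ℕ.z≤n) (ℤ.i≤j⇒0≤j-i (+≤+ (outdegree≤ i j))))
    (rearrange (+ outdegree T i) (+ outdegree T j) (+ n - 1ℤ))

regular⊎almostRegular⇒balanced : {T : Matrix n} → Regular T ⊎ AlmostRegular T → Balanced T
regular⊎almostRegular⇒balanced {T = T} (inj₁ (t , equal)) = closeOutdegrees⇒balanced t λ i j →
  subst (ℕ._≤ 1) (sym (ℕ.m≡n⇒∣m-n∣≡0 (equal i j))) ℕ.z≤n
regular⊎almostRegular⇒balanced (inj₂ (t , _ , close)) = closeOutdegrees⇒balanced t close

evenIndicator-double : ∀ m → evenIndicator (m ℕ.+ m) ≡ 1ℤ
evenIndicator-double zero    = refl
evenIndicator-double (suc m) rewrite ℕ.+-suc m m | evenIndicator-double m = refl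

evenIndicator≤1 : ∀ n → evenIndicator n ≤ 1ℤ
evenIndicator≤1 n with evenIndicator-01 n
... | inj₁ e = subst (_≤ 1ℤ) (sym e) (+≤+ ℕ.z≤n)
... | inj₂ e = ℤ.≤-reflexive e

-- In even order all imbalances are odd.
evenIndicator≤imbalance² : {T : Matrix n} → IsTournament T → ∀ i →
  evenIndicator n ≤ imbalance T i * imbalance T i
evenIndicator≤imbalance² {n} {T} t i with imbalance T i ℤ.≟ 0ℤ
... | no  D≢0 = ℤ.≤-trans (evenIndicator≤1 n) (≢0⇒1≤square (imbalance T i) D≢0)
... | yes D≡0 = subst (_≤ imbalance T i * imbalance T i) (sym e≡0) (square-nonNeg (imbalance T i))
  where
  o = outdegree T i
  double : ∀ a N → + 2 * a - (N - 1ℤ) ≡ 1ℤ + (a + a) - N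
  double = solve-∀
  n≡ : n ≡ suc (o ℕ.+ o)
  n≡ = sym (ℤ.+-injective (ℤ.i-j≡0⇒i≡j (1ℤ + (+ o + + o)) (+ n)
    (trans (sym (double (+ o) (+ n))) (trans (sym (imbalance-outdegree t i)) D≡0))))
  e≡0 : evenIndicator n ≡ 0ℤ
  e≡0 = trans (cong evenIndicator n≡) (cong (λ x → 1ℤ - x) (evenIndicator-double o))

-- Both `M` and `extremal n` exceed the energy of their remainder by N² + N, so the remainder of `M`
-- has at most the energy e N of `alternating n`. Each squared imbalance is at least e by parity,
-- hence equal to e, and e ≤ 1.
acyclicVertex⇒regularRest : {M : Matrix (suc n)} → SingularMaximizer M → ∀ v →
  (∀ j k → ¬ DirectedCycle M v j k) → Regular (minor M v v) ⊎ AlmostRegular (minor M v v)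
acyclicVertex⇒regularRest {n} {M} ((t , _) , maximal) v acyclic =
  balanced⇒regular⊎almostRegular tT λ i → square≤1⇒bounds (D i)
    (subst (_≤ 1ℤ) (sym (ℤ.i-j≡0⇒i≡j (D i * D i) e (excess≡0 i))) (evenIndicator≤1 n))
  where
  open AddedVertex M v
  e = evenIndicator n
  tT : IsTournament T
  tT = minor-isTournament t v
  cancel : ∀ a b c → b - a ≡ b + c - (a + c)
  cancel = solve-∀
  energyT≤ : energy T ≤ e * N
  energyT≤ = subst (energy T ≤_) (energy-alternating n) (≤-from-difference
    (ℤ.i≤j⇒0≤j-i (subst₂ _≤_ (acyclic⇒energy t acyclic)
      (AddedVertex.acyclic⇒energy (extremal n) zero (proj₁ (extremal-∈𝒮 n)) extremal-acyclic)
      (C₃-antitone t (proj₁ (extremal-∈𝒮 n)) (maximal (extremal n) (extremal-∈𝒮 n)))))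
    (cancel (energy T) (energy (alternating n)) (N * N + N)))
  weights : ∀ a e → a - e ≡ 1ℤ * a + - e * 1ℤ
  weights = solve-∀
  collect : ∀ E e N → 1ℤ * E + - e * N ≡ E - e * N
  collect = solve-∀
  ∑excess : ∑[ i < n ] (D i * D i - e) ≡ energy T - e * N
  ∑excess = begin
    ∑[ i < n ] (D i * D i - e)                 ≡⟨ sum-cong-≗ (λ i → weights (D i * D i) e) ⟩
    ∑[ i < n ] (1ℤ * (D i * D i) + - e * 1ℤ)   ≡⟨ ∑-linear 1ℤ (- e) (λ i → D i * D i) (λ _ → 1ℤ) ⟩
    1ℤ * energy T + - e * ∑[ i < n ] 1ℤ        ≡⟨ cong (λ x → 1ℤ * energy T + - e * x) (∑-one n) ⟩
    1ℤ * energy T + - e * N                    ≡⟨ collect (energy T) e N ⟩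
    energy T - e * N                           ∎
  excess≡0 : ∀ i → D i * D i - e ≡ 0ℤ
  excess≡0 = ∑-nonNeg-zero (λ i → D i * D i - e)
    (λ i → ℤ.i≤j⇒0≤j-i (evenIndicator≤imbalance² tT i))
    (subst (_≤ 0ℤ) (sym ∑excess) (ℤ.i≤j⇒i-j≤0 energyT≤))

-- Vertices added to regular or almost regular tournaments

-- Here x stands for -∑ rD. Eliminating it leaves (N - R)(N + R - 2) ≤ N, which fails for 0 ≤ R < N
-- once N ≥ 4.
large-or-small : ∀ N R x → 0ℤ ≤ R → R ≤ N → N * N ≤ R * R + N + + 2 * x → x ≤ N - R →
  R ≡ N ⊎ N ≤ + 3
large-or-small N R x 0≤R R≤N N²≤ x≤ with R ℤ.≟ N | N ℤ.≤? + 3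
... | yes R≡N | _       = inj₁ R≡N
... | no  _   | yes N≤3 = inj₂ N≤3
... | no  R≢N | no  N≰3 = contradiction (≤-from-difference certificate (combination N R x))
                                        (ℤ.<⇒≱ R<N)
  where
  R<N : R < N
  R<N = ℤ.≤∧≢⇒< R≤N R≢N
  gap : 0ℤ ≤ N - (1ℤ + R)
  gap = ℤ.i≤j⇒0≤j-i (ℤ.i<j⇒suc[i]≤j R<N)
  -- The summands are nonnegative by the hypotheses, R < N and N ≥ 4, yet they add up to R - N.
  certificate : 0ℤ ≤ (R * R + N + + 2 * x - N * N) + + 2 * (N - R - x)
    + (N - (1ℤ + R)) * R + (N - R) * (N - + 4)
  certificate = ℤ.+-mono-≤ (ℤ.+-mono-≤ (ℤ.+-mono-≤
    (ℤ.i≤j⇒0≤j-i N²≤)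
    (*-nonNeg {+ 2} (+≤+ ℕ.z≤n) (ℤ.i≤j⇒0≤j-i x≤)))
    (*-nonNeg gap 0≤R))
    (*-nonNeg (ℤ.i≤j⇒0≤j-i R≤N) (ℤ.i≤j⇒0≤j-i (ℤ.i<j⇒suc[i]≤j (ℤ.≰⇒> N≰3))))
  combination : ∀ N R x → R - N ≡ (R * R + N + + 2 * x - N * N) + + 2 * (N - R - x)
    + (N - (1ℤ + R)) * R + (N - R) * (N - + 4)
  combination = solve-∀

≥0∧≢0⇒≥1 : ∀ {a} → 0ℤ ≤ a → a ≢ 0ℤ → 1ℤ ≤ a
≥0∧≢0⇒≥1 0≤a a≢0 = ℤ.i<j⇒suc[i]≤j (ℤ.≤∧≢⇒< 0≤a (a≢0 ∘ sym))

HasSourceOrSink : Matrix n → Set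
HasSourceOrSink M = ∃[ w ] (Source M w ⊎ Sink M w)

-- If all in- and outdegrees are at least 1, every imbalance is at most B = n - 2 in absolute value,
-- so the energy is at most B²(n + 1). The required (n + 1)n exceeds this for n = 2 and 3; at n = 4
-- the two are equal and the argument stops.
smallOrder⇒sourceOrSink : {M : Matrix (suc n)} → IsTournament M → n ℕ.≤ 3 →
  + suc n * (+ suc n - 1ℤ) ≤ energy M → HasSourceOrSink M
smallOrder⇒sourceOrSink {n} {M} t n≤3 energy≥
  with Fin.any? (λ w → (inSum t w ℤ.≟ 0ℤ) ⊎-dec (outSum t w ℤ.≟ 0ℤ))
... | yes (w , inj₁ in≡0)  = w , inj₁ (inSum≡0⇒source t w in≡0)
... | yes (w , inj₂ out≡0) = w , inj₂ (outSum≡0⇒sink t w out≡0)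
... | no  none = ⊥-elim (absurd n≤3 (lower zero) (upper zero) (ℤ.≤-trans energy≥ energy≤))
  where
  D = imbalance M
  B = + n - + 2
  rearrange-in : ∀ N s → N - + 2 - (1ℤ + N - 1ℤ - + 2 * s) ≡ + 2 * (s - 1ℤ)
  rearrange-in = solve-∀
  rearrange-out : ∀ N s → + 2 * s - (1ℤ + N - 1ℤ) - - (N - + 2) ≡ + 2 * (s - 1ℤ)
  rearrange-out = solve-∀
  upper : ∀ i → D i ≤ B
  upper i = subst (_≤ B) (sym (imbalance-inSum t i)) (≤-from-difference
    (*-nonNeg {+ 2} (+≤+ ℕ.z≤n) (ℤ.i≤j⇒0≤j-i (≥0∧≢0⇒≥1
      (∑-nonNeg (λ j → entry-nonNeg t j i)) (λ e → none (i , inj₁ e)))))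
    (rearrange-in (+ n) (inSum t i)))
  lower : ∀ i → - B ≤ D i
  lower i = subst (- B ≤_) (sym (imbalance-outSum t i)) (≤-from-difference
    (*-nonNeg {+ 2} (+≤+ ℕ.z≤n) (ℤ.i≤j⇒0≤j-i (≥0∧≢0⇒≥1
      (∑-nonNeg (entry-nonNeg t i)) (λ e → none (i , inj₂ e)))))
    (rearrange-out (+ n) (outSum t i)))
  energy≤ : energy M ≤ B * B * + suc n
  energy≤ = ℤ.≤-trans
    (∑-mono-≤ {g = λ _ → B * B * 1ℤ} λ i →
      subst (D i * D i ≤_) (sym (ℤ.*-identityʳ (B * B))) (bounds⇒square≤ B (lower i) (upper i)))
    (ℤ.≤-reflexive (trans (sym (*-distribˡ-sum {suc n} (B * B) (λ _ → 1ℤ)))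
                          (cong (B * B *_) (∑-one (suc n)))))
  -- For n ≤ 1 the bound B is negative, and the interval for d is empty. For n = 2 and 3 the energy
  -- bounds read 6 ≤ 0 and 12 ≤ 4.
  absurd : ∀ {n} {d : ℤ} → n ℕ.≤ 3 → - (+ n - + 2) ≤ d → d ≤ + n - + 2 →
    + suc n * (+ suc n - 1ℤ) ≤ (+ n - + 2) * (+ n - + 2) * + suc n → ⊥
  absurd {0} _ l u _ = contradiction (ℤ.≤-trans l u) λ ()
  absurd {1} _ l u _ = contradiction (ℤ.≤-trans l u) λ ()
  absurd {2} _ _ _ (+≤+ ())
  absurd {3} _ _ _ (+≤+ (ℕ.s≤s (ℕ.s≤s (ℕ.s≤s (ℕ.s≤s ())))))
  absurd {suc (suc (suc (suc n)))} (ℕ.s≤s (ℕ.s≤s (ℕ.s≤s ())))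

-- The alternative |R| = N makes v itself a source or a sink. Otherwise the order is at most 4, and
-- the vertex found need not be v.
balancedRest⇒sourceOrSink : {M : Matrix (suc n)} → M ∈𝒮 → ∀ v → Balanced (minor M v v) →
  HasSourceOrSink M
balancedRest⇒sourceOrSink {n} {M} (t , detM≡0) v balanced = byDirection (ℤ.≤-total 0ℤ R)
  where
  open AddedVertex M v
  r-bounds : ∀ j → -1ℤ ≤ r j × r j ≤ 1ℤ
  r-bounds j = square≤1⇒bounds (r j) (ℤ.≤-reflexive (r-square t j))

  R≤N : R ≤ N
  R≤N = subst (R ≤_) (∑-one n) (∑-mono-≤ (proj₂ ∘ r-bounds))
  -R≤N : - R ≤ N
  -R≤N = subst₂ _≤_ (∑-neg r) (∑-one n) (∑-mono-≤ (ℤ.neg-mono-≤ ∘ proj₁ ∘ r-bounds))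

  energyT≤N : energy T ≤ N
  energyT≤N = subst (energy T ≤_) (∑-one n)
    (∑-mono-≤ λ j → bounds⇒square≤ 1ℤ (proj₁ (balanced j)) (proj₂ (balanced j)))

  energy≥ : + suc n * (+ suc n - 1ℤ) ≤ energy M
  energy≥ = singular⇒energy≥ t detM≡0

  N²≤ : N * N ≤ R * R + N + + 2 * (- rD)
  N²≤ = ≤-from-difference
    (ℤ.+-mono-≤ (ℤ.i≤j⇒0≤j-i (subst (+ suc n * (+ suc n - 1ℤ) ≤_) (energy-decomposition t) energy≥))
                (ℤ.i≤j⇒0≤j-i energyT≤N))
    (rearrange N R (energy T) rD)
    where
    rearrange : ∀ N R E p → R * R + N + + 2 * (- p) - N * N
      ≡ R * R + E - + 2 * p + N - (1ℤ + N) * (1ℤ + N - 1ℤ) + (N - E)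
    rearrange = solve-∀

  -- For c = 1 and c = -1 both factors are nonnegative, which gives the two bounds on `- rD`. The
  -- term linear in D drops out because imbalances sum to 0.
  product-sum : ∀ c → ∑[ j < n ] ((1ℤ - c * r j) * (1ℤ - c * D j)) ≡ N - c * R + c * c * rD
  product-sum c = begin
    ∑[ j < n ] ((1ℤ - c * r j) * (1ℤ - c * D j))
      ≡⟨ sum-cong-≗ (λ j → expand c (r j) (D j)) ⟩
    ∑[ j < n ] (1ℤ * (1ℤ * 1ℤ + - c * r j + - c * D j) + c * c * (r j * D j))
      ≡⟨ ∑-linear 1ℤ (c * c) (λ j → 1ℤ * 1ℤ + - c * r j + - c * D j) (λ j → r j * D j) ⟩
    1ℤ * ∑[ j < n ] (1ℤ * 1ℤ + - c * r j + - c * D j) + c * c * rD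
      ≡⟨ cong (λ x → 1ℤ * x + c * c * rD) (∑-linear₃ 1ℤ (- c) (- c) (λ _ → 1ℤ) r D) ⟩
    1ℤ * (1ℤ * (∑[ j < n ] 1ℤ) + - c * R + - c * sum D) + c * c * rD
      ≡⟨ cong₂ (λ x y → 1ℤ * (1ℤ * x + - c * R + - c * y) + c * c * rD) (∑-one n) (∑-imbalance T) ⟩
    1ℤ * (1ℤ * N + - c * R + - c * 0ℤ) + c * c * rD
      ≡⟨ collect c N R rD ⟩
    N - c * R + c * c * rD ∎
    where
    expand : ∀ c r d → (1ℤ - c * r) * (1ℤ - c * d)
      ≡ 1ℤ * (1ℤ * 1ℤ + - c * r + - c * d) + c * c * (r * d)
    expand = solve-∀
    collect : ∀ c N R p → 1ℤ * (1ℤ * N + - c * R + - c * 0ℤ) + c * c * p ≡ N - c * R + c * c * p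
    collect = solve-∀

  -rD≤N-R : - rD ≤ N - R
  -rD≤N-R = ≤-from-difference (∑-nonNeg λ j → *-nonNeg (1-nonNeg (proj₂ (r-bounds j))) (1-nonNeg (proj₂ (balanced j))))
    (trans (rearrange N R rD) (sym (product-sum 1ℤ)))
    where
    1-nonNeg : ∀ {a} → a ≤ 1ℤ → 0ℤ ≤ 1ℤ - 1ℤ * a
    1-nonNeg {a} a≤1 = ℤ.i≤j⇒0≤j-i (subst (_≤ 1ℤ) (sym (ℤ.*-identityˡ a)) a≤1)
    rearrange : ∀ N R p → N - R - - p ≡ N - 1ℤ * R + 1ℤ * 1ℤ * p
    rearrange = solve-∀

  -rD≤N+R : - rD ≤ N - - R
  -rD≤N+R = ≤-from-difference (∑-nonNeg λ j → *-nonNeg (1-nonNeg (proj₁ (r-bounds j))) (1-nonNeg (proj₁ (balanced j))))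
    (trans (rearrange N R rD) (sym (product-sum -1ℤ)))
    where
    1-nonNeg : ∀ {a} → -1ℤ ≤ a → 0ℤ ≤ 1ℤ - -1ℤ * a
    1-nonNeg {a} -1≤a = ℤ.i≤j⇒0≤j-i (subst (_≤ 1ℤ) (sym (ℤ.-1*i≡-i a)) (ℤ.neg-mono-≤ -1≤a))
    rearrange : ∀ N R p → N - - R - - p ≡ N - -1ℤ * R + -1ℤ * -1ℤ * p
    rearrange = solve-∀

  halve : ∀ s → + 2 * s ≡ 0ℤ → s ≡ 0ℤ
  halve s = ≢0∧*≡0⇒≡0 (+ 2) s λ ()

  R≡N⇒source : R ≡ N → Source M v
  R≡N⇒source R≡N = inSum≡0⇒source t v (halve (inSum t v) (begin
    + 2 * inSum t v                          ≡⟨ expose N (inSum t v) ⟩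
    N - (+ suc n - 1ℤ - + 2 * inSum t v)     ≡⟨ cong (λ x → N - x) (trans (sym (imbalance-inSum t v)) imbalance-v) ⟩
    N - R                                    ≡⟨ ℤ.i≡j⇒i-j≡0 (sym R≡N) ⟩
    0ℤ                                       ∎))
    where
    expose : ∀ N s → + 2 * s ≡ N - (1ℤ + N - 1ℤ - + 2 * s)
    expose = solve-∀

  -R≡N⇒sink : - R ≡ N → Sink M v
  -R≡N⇒sink -R≡N = outSum≡0⇒sink t v (halve (outSum t v) (begin
    + 2 * outSum t v                             ≡⟨ expose N (outSum t v) ⟩
    N - - (+ 2 * outSum t v - (+ suc n - 1ℤ))    ≡⟨ cong (λ x → N - - x) (trans (sym (imbalance-outSum t v)) imbalance-v) ⟩
    N - - R                                      ≡⟨ ℤ.i≡j⇒i-j≡0 (sym -R≡N) ⟩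
    0ℤ                                           ∎))
    where
    expose : ∀ N s → + 2 * s ≡ N - - (+ 2 * s - (1ℤ + N - 1ℤ))
    expose = solve-∀

  small : N ≤ + 3 → HasSourceOrSink M
  small N≤3 = smallOrder⇒sourceOrSink t (ℤ.drop‿+≤+ N≤3) energy≥

  negate-square : ∀ R → - R * - R ≡ R * R
  negate-square = solve-∀

  -- Reversing all arcs negates r and D, hence R, but keeps `rD`; so the second case repeats the
  -- first with - R.
  byDirection : 0ℤ ≤ R ⊎ R ≤ 0ℤ → HasSourceOrSink M
  byDirection (inj₁ 0≤R) = [ (λ R≡N → v , inj₁ (R≡N⇒source R≡N)) , small ]′
    (large-or-small N R (- rD) 0≤R R≤N N²≤ -rD≤N-R)
  byDirection (inj₂ R≤0) = [ (λ -R≡N → v , inj₂ (-R≡N⇒sink -R≡N)) , small ]′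
    (large-or-small N (- R) (- rD) (ℤ.neg-mono-≤ R≤0) -R≤N
      (subst (λ q → N * N ≤ q + N + + 2 * (- rD)) (sym (negate-square R)) N²≤) -rD≤N+R)

-- Strong components

module _ {M : Matrix n} (t : IsTournament M) where

  beats-irreflexive : ∀ {i} → ¬ Beats M i i
  beats-irreflexive {i} Mᵢᵢ≡1 = contradiction (trans (sym (diagonal≡0 t i)) Mᵢᵢ≡1) λ ()

  beats-asymmetric : ∀ {i j} → Beats M i j → ¬ Beats M j i
  beats-asymmetric {i} {j} Mᵢⱼ≡1 Mⱼᵢ≡1 with i Fin.≟ j
  ... | yes refl = beats-irreflexive Mᵢⱼ≡1
  ... | no  i≢j with arc t i j i≢j
  ...   | forward  _ Mⱼᵢ≡0 = contradiction (trans (sym Mⱼᵢ≡0) Mⱼᵢ≡1) λ ()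
  ...   | backward Mᵢⱼ≡0 _ = contradiction (trans (sym Mᵢⱼ≡0) Mᵢⱼ≡1) λ ()

  source-unbeaten : ∀ {v} → Source M v → ∀ u → ¬ Beats M u v
  source-unbeaten {v} source u u→v with u Fin.≟ v
  ... | yes refl = beats-irreflexive u→v
  ... | no  u≢v  = beats-asymmetric u→v (source u u≢v)

  sink-beatsNone : ∀ {v} → Sink M v → ∀ u → ¬ Beats M v u
  sink-beatsNone {v} sink u v→u with u Fin.≟ v
  ... | yes refl = beats-irreflexive v→u
  ... | no  u≢v  = beats-asymmetric v→u (sink u u≢v)

  sourceOrSink-acyclic : ∀ {v} → Source M v ⊎ Sink M v → ∀ j k → ¬ DirectedCycle M v j k
  sourceOrSink-acyclic (inj₁ source) j k (_ , _ , k→v) = source-unbeaten source k k→v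
  sourceOrSink-acyclic (inj₂ sink)   j k (v→j , _)     = sink-beatsNone sink j v→j

  walkToSource : ∀ {u v} → Source M v → Walk M u v → u ≡ v
  walkToSource source ε = refl
  walkToSource source (u→w ◅ walk) with refl ← walkToSource source walk =
    contradiction u→w (source-unbeaten source _)

  walkFromSink : ∀ {u v} → Sink M v → Walk M v u → u ≡ v
  walkFromSink sink ε           = refl
  walkFromSink sink (v→w ◅ _) = contradiction v→w (sink-beatsNone sink _)

  sourceOrSink⇒component : ∀ {v} → Source M v ⊎ Sink M v → HasStrongComponentOfOrder 1 M
  sourceOrSink⇒component {v} extreme =
    ⁅ v ⁆ , (v , λ w → mk⇔ (λ w∈ → reflexive (x∈⁅y⁆⇒x≡y v w∈))
                          (λ walks → subst (_∈ ⁅ v ⁆) (sym (alone extreme walks)) (x∈⁅x⁆ v))) ,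
    ∣⁅x⁆∣≡1 v
    where
    reflexive : ∀ {w} → w ≡ v → MutuallyReachable M v w
    reflexive refl = ε , ε
    alone : ∀ {w} → Source M v ⊎ Sink M v → MutuallyReachable M v w → w ≡ v
    alone (inj₁ source) (_ , w⇒v) = walkToSource source w⇒v
    alone (inj₂ sink)   (v⇒w , _) = walkFromSink sink v⇒w

-- If x and y differed, removing x and then y would lower the cardinality twice.
∣p∣≡1⇒≡ : ∀ {p : Subset n} {x y} → ∣ p ∣ ≡ 1 → x ∈ p → y ∈ p → x ≡ y
∣p∣≡1⇒≡ {p = p} {x} {y} ∣p∣≡1 x∈p y∈p with x Fin.≟ y
... | yes x≡y = x≡y
... | no  x≢y = contradiction
  (ℕ.≤-trans (ℕ.s≤s (ℕ.≤-<-trans ℕ.z≤n (x∈p⇒∣p-x∣<∣p∣ (x∈p∧x≢y⇒x∈p-y y∈p (x≢y ∘ sym)))))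
             (x∈p⇒∣p-x∣<∣p∣ x∈p))
  (subst (λ c → ¬ 2 ℕ.≤ c) (sym ∣p∣≡1) λ { (ℕ.s≤s ()) })

-- A 3-cycle through v puts its next vertex j into the component of v, so j = v and v would beat
-- itself.
component⇒acyclicVertex : {M : Matrix n} → IsTournament M → HasStrongComponentOfOrder 1 M →
  ∃[ v ] (∀ j k → ¬ DirectedCycle M v j k)
component⇒acyclicVertex {M = M} t (S , (v , class) , ∣S∣≡1) = v , λ j k (v→j , j→k , k→v) →
  beats-irreflexive t (subst (Beats M v) (sym (∣p∣≡1⇒≡ ∣S∣≡1
    (Equivalence.from (class v) (ε , ε))
    (Equivalence.from (class j) (v→j ◅ ε , j→k ◅ k→v ◅ ε)))) v→j)

-- The implications between the three conditions

module _ {M : Matrix (suc m)} (maximizer : SingularMaximizer M) where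

  private
    M∈𝒮 = proj₁ maximizer
    t   = proj₁ M∈𝒮

  trivial⇒addsSourceOrSink : TrivialSingularMaximizer M → AddsSourceOrSink M
  trivial⇒addsSourceOrSink (_ , T , regular , v , adds) =
    let w , extreme = balancedRest⇒sourceOrSink M∈𝒮 v λ i →
          subst (λ d → -1ℤ ≤ d × d ≤ 1ℤ)
                (sum-cong-≗ λ j → sym (cong₂ _-_ (adds i j) (adds j i)))
                (regular⊎almostRegular⇒balanced regular i)
    -- Since w may differ from v, `T` cannot be reused: the remainder at w is regular or almost
    -- regular by maximality.
    in minor M w w ,
       acyclicVertex⇒regularRest maximizer w (sourceOrSink-acyclic t extreme) ,
       w , (λ _ _ → refl) , extreme

  addsSourceOrSink⇒trivial : AddsSourceOrSink M → TrivialSingularMaximizer M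
  addsSourceOrSink⇒trivial (T , regular , v , adds , _) = maximizer , T , regular , v , adds

  addsSourceOrSink⇒component : AddsSourceOrSink M → HasStrongComponentOfOrder 1 M
  addsSourceOrSink⇒component (_ , _ , _ , _ , extreme) = sourceOrSink⇒component t extreme

  component⇒trivial : HasStrongComponentOfOrder 1 M → TrivialSingularMaximizer M
  component⇒trivial component =
    let v , acyclic = component⇒acyclicVertex t component
    in maximizer , minor M v v , acyclicVertex⇒regularRest maximizer v acyclic , v , λ _ _ → refl

theorem2p7 : ∀ (m : ℕ) (M : Matrix (suc m)) → SingularMaximizer M →
    (TrivialSingularMaximizer M ⇔ AddsSourceOrSink M)
    × (AddsSourceOrSink M ⇔ HasStrongComponentOfOrder 1 M)
theorem2p7 m M maximizer =
  mk⇔ (trivial⇒addsSourceOrSink maximizer) (addsSourceOrSink⇒trivial maximizer) ,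
  mk⇔ (addsSourceOrSink⇒component maximizer)
      (trivial⇒addsSourceOrSink maximizer ∘ component⇒trivial maximizer)
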